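{- Let $k\geq3$, $m$, $d\geq2$ be integers with $1\leq m<k/2$, and let $(a_1,\dots,a_p)$ be an integer tuple with $0\leq a_1<\cdots<a_p\leq d-2$. Let $n=kd-1$, $v=md-1$, $w=(k-m)d-1$, and for $(i,j)\in\{1,\dots,k\}\times\{1,\dots,p\}$ let $u_{(i,j)}=(i-1)d+a_j$. Let $P_n$ be the path on $n$ vertices labeled $0,1,\dots,n-1$ in order along the path. Then for any rooted graph $G$ with root $r$, the multiple coalescences $$P_n(v\!=\!r)G(u_{(1,1)}\!=\!r)G(u_{(1,2)}\!=\!r)G\cdots(u_{(k,p)}\!=\!r)G$$ and $$P_n(w\!=\!r)G(u_{(1,1)}\!=\!r)G(u_{(1,2)}\!=\!r)G\cdots(u_{(k,p)}\!=\!r)G$$ are cospectral.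
   Context: Two graphs are cospectral if their adjacency matrices have the same characteristic polynomial. For a graph $T$ with distinct vertices $x_1,\dots,x_s$ and a rooted graph $G$ with root $r$, the multiple coalescence $T(x_1\!=\!r)G\cdots(x_s\!=\!r)G$ is the graph obtained from the disjoint union of $T$ and $s$ separate copies of $G$ by identifying $x_i$ with the root of the $i$-th copy of $G$, for each $i$ (so exactly one copy of $G$ is attached at each listed vertex). -}

module Defs where

open import Data.Bool using (Bool; true; false; _∧_; _∨_; if_then_else_)
open import Data.Nat as ℕ using (ℕ; zero; suc; pred)
open import Data.Integer as ℤ using (ℤ; 0ℤ; 1ℤ)
open import Data.Fin as Fin using (Fin; zero; suc; toℕ; punchIn; splitAt; remQuot)
open import Data.List using (List; []; _∷_)
open import Data.Sum using (_⊎_; inj₁; inj₂)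
open import Data.Product using (_×_; _,_)
open import Relation.Nullary.Decidable using (⌊_⌋)
open import Relation.Binary.PropositionalEquality using (_≡_)
open import Data.Empty using (⊥)

record Graph : Set where
  field
    n     : ℕ
    adj   : Fin n → Fin n → Bool
    sym   : ∀ i j → adj i j ≡ adj j i
    irref : ∀ i → adj i i ≡ false

record RootedGraph : Set where
  field
    graph : Graph
    root  : Fin (Graph.n graph)
  open Graph graph public

-- Polynomials over ℤ as coefficient lists (lowest degree first)

Poly : Set
Poly = List ℤ

infixl 6 _+P_
_+P_ : Poly → Poly → Poly
[] +P q = q
(a ∷ p) +P [] = a ∷ p
(a ∷ p) +P (b ∷ q) = (a ℤ.+ b) ∷ (p +P q)

scaleP : ℤ → Poly → Poly
scaleP c [] = []
scaleP c (a ∷ p) = (c ℤ.* a) ∷ scaleP c p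

negP : Poly → Poly
negP = scaleP (ℤ.- 1ℤ)

infixl 7 _*P_
_*P_ : Poly → Poly → Poly
[] *P q = []
(a ∷ p) *P q = scaleP a q +P (0ℤ ∷ (p *P q))

constP : ℤ → Poly
constP c = c ∷ []

varP : Poly
varP = 0ℤ ∷ 1ℤ ∷ []

coeff : Poly → ℕ → ℤ
coeff [] i = 0ℤ
coeff (a ∷ p) zero = a
coeff (a ∷ p) (suc i) = coeff p i

_≈P_ : Poly → Poly → Set
p ≈P q = ∀ i → coeff p i ≡ coeff q i

altSum : ∀ {n} → (Fin n → Poly) → Poly
altSum {zero} f = []
altSum {suc n} f = f zero +P negP (altSum (λ j → f (suc j)))

det : ∀ n → (Fin n → Fin n → Poly) → Poly
det zero M = constP 1ℤ
det (suc n) M =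
  altSum (λ j → M zero j *P det n (λ a b → M (suc a) (punchIn j b)))

b2ℤ : Bool → ℤ
b2ℤ true = 1ℤ
b2ℤ false = 0ℤ

charPoly : ∀ n → (Fin n → Fin n → Bool) → Poly
charPoly n A = det n (λ i j →
  (if ⌊ i Fin.≟ j ⌋ then varP else []) +P negP (constP (b2ℤ (A i j))))

record AdjGraph : Set where
  constructor mkAdj
  field
    size : ℕ
    mat  : Fin size → Fin size → Bool

Cospectral : AdjGraph → AdjGraph → Set
Cospectral (mkAdj n A) (mkAdj n' A') = charPoly n A ≈P charPoly n' A'

pathAdj : ∀ n → Fin n → Fin n → Bool
pathAdj n i j = ⌊ suc (toℕ i) ℕ.≟ toℕ j ⌋ ∨ ⌊ suc (toℕ j) ℕ.≟ toℕ i ⌋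

-- Multiple coalescence T(x_1=r)G ⋯ (x_s=r)G
--
-- Vertices: the n vertices of T, plus for each copy i ∈ Fin s the
-- non-root vertices of G (indexed by Fin (pred |G|) via punchIn root).
-- The root of copy i is identified with x i.

nonRoot : ∀ {g} → Fin g → Fin (pred g) → Fin g
nonRoot {suc g} r j = punchIn r j

coalesce : ∀ {n s} → (Fin n → Fin n → Bool) → (G : RootedGraph)
         → (Fin s → Fin n) → AdjGraph
coalesce {n} {s} T G x =
  mkAdj (n ℕ.+ s ℕ.* pred g) (λ a b → adjV (dec a) (dec b))
  where
    open RootedGraph G renaming (n to g)
    V : Set
    V = Fin n ⊎ (Fin s × Fin (pred g))
    dec : Fin (n ℕ.+ s ℕ.* pred g) → V
    dec a with splitAt n a
    ... | inj₁ t = inj₁ t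
    ... | inj₂ c = inj₂ (remQuot {s} (pred g) c)
    adjV : V → V → Bool
    adjV (inj₁ t) (inj₁ t') = T t t'
    adjV (inj₁ t) (inj₂ (i , j)) = ⌊ t Fin.≟ x i ⌋ ∧ adj root (nonRoot root j)
    adjV (inj₂ (i , j)) (inj₁ t) = ⌊ t Fin.≟ x i ⌋ ∧ adj (nonRoot root j) root
    adjV (inj₂ (i , j)) (inj₂ (i' , j')) =
      ⌊ i Fin.≟ i' ⌋ ∧ adj (nonRoot root j) (nonRoot root j')

-- The attachment points u_(i,j) = (i-1) d + a_j, listed in lexicographic
-- order of (i,j) ∈ {1..k} × {1..p}; here i is 0-based, so (i-1) = toℕ i.

uPoint : ∀ k p d → (Fin p → ℕ) → Fin (k ℕ.* p) → ℕ
uPoint k p d a t with remQuot {k} p t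
... | (i , j) = toℕ i ℕ.* d ℕ.+ a j

{-# OPTIONS --safe #-}
-- Let H be the path with the copies of G at the points u_(i,j). Laplace
-- expansion along the row of v gives
--   φ(H(v=r)G) = φ(G) φ(H - v) + φ(G - r) (φ(H) - x φ(H - v)),
-- so only H - v matters. Deleting v = md - 1 cuts H into an initial segment of
-- m blocks and a translate of an initial segment of k - m blocks; deleting
-- w = (k-m)d - 1 yields the same two pieces in the other order. The
-- determinants are taken over lists of vertices, where reordering vertices is
-- a list permutation.
module Submission where

open import Defs
open import Algebra.Bundles using (CommutativeMonoid; CommutativeRing)
open import Data.Bool using (Bool; true; false; _∧_; _∨_; if_then_else_)
open import Data.Empty using (⊥-elim)
open import Data.Fin as Fin using (Fin; zero; suc; toℕ; punchIn; splitAt; join; remQuot; combine)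
import Data.Fin.Properties as Fin
open import Data.Integer as ℤ using (ℤ; 0ℤ; 1ℤ)
import Data.Integer.Properties as ℤₚ
open import Data.List using (List; []; _∷_; _++_; map; length; drop; tabulate; allFin; upTo; applyUpTo; concat; concatMap)
open import Data.List.Properties
  using (length-map; map-∘; map-cong; map-++; map-tabulate; tabulate-cong; map-upTo; ++-assoc;
         concat-map; concat-++; concatMap-map; map-concatMap; concatMap-++)
open import Data.List.Relation.Binary.Permutation.Propositional as Permutation
  using (_↭_; prep; ↭-trans; ↭-sym; ↭-reflexive; module PermutationReasoning)
import Data.List.Relation.Binary.Permutation.Propositional.Properties as ↭
open import Data.List.Relation.Binary.Pointwise using (Pointwise; []; _∷_)
open import Data.List.Relation.Unary.All as All using (All; []; _∷_)
import Data.List.Relation.Unary.All.Properties as All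
open import Data.Maybe using (Maybe; just; nothing)
import Data.Maybe.Properties as Maybe
open import Data.Nat as ℕ using (ℕ; zero; suc; pred; z≤n; s≤s)
import Data.Nat.Properties as ℕₚ
open import Data.Product as Product using (_×_; _,_; proj₁; proj₂)
import Data.Product.Properties as Product
open import Data.Sum as Sum using (_⊎_; inj₁; inj₂)
import Data.Sum.Properties as Sum
open import Data.Unit using (⊤; tt)
open import Function using (_∘_; id)
open import Level using (0ℓ)
open import Relation.Binary.Definitions using (DecidableEquality)
open import Relation.Binary.PropositionalEquality as ≡ using (_≡_; _≢_; cong; cong₂)
import Relation.Binary.Reasoning.Setoid as SetoidReasoning
open import Relation.Binary.Structures using (IsEquivalence)
open import Relation.Nullary using (Dec; yes; no; ¬_)
open import Relation.Nullary.Decidable using (⌊_⌋)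

-- Deleting a vertex or translating a segment would mean reindexing `Fin`. Instead all vertices live
-- in one unbounded type labelled by naturals, with one matrix for each position `c` of the extra
-- copy, and an induced subgraph is just a list of labels. The determinant therefore takes a list of
-- rows, given as functions, and a list of column labels; the bridge to `det` is an equality of
-- expressions, so `det` needs no theory of its own.
--
-- The lengths fit because (r d - 1) + 1 + (r′ d - 1) = (r + r′) d - 1, and translation by r d
-- carries the attachment points of block i to those of block r + i. The correction - x φ(H - v)
-- appears because the diagonal entry of row v belongs to both graphs glued at v but occurs only
-- once in the matrix of the coalescence.

module ListDeterminant {c ℓ} (R : CommutativeRing c ℓ) where
  open Permutation using (_↭_; refl; prep; swap; trans)
  open CommutativeRing R hiding (refl; trans)
  open CommutativeRing R using () renaming (refl to ≈-refl; trans to ≈-trans)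
  open import Algebra.Properties.Ring ring
    using (-‿distribˡ-*; -‿distribʳ-*; -0#≈0#; -‿involutive)
  open import Algebra.Properties.AbelianGroup +-abelianGroup
    using () renaming (⁻¹-anti-homo‿- to -‿anti-homo-‿-; ⁻¹-∙-comm to -‿+-comm)
  open import Algebra.Properties.CommutativeSemigroup +-commutativeSemigroup
    using () renaming (interchange to +-interchange)
  open import Algebra.Properties.CommutativeSemigroup *-commutativeSemigroup
    using () renaming (x∙yz≈y∙xz to x*yz≈y*xz; interchange to *-interchange)
  open import Relation.Binary.Reasoning.Setoid setoid

  -- Determinants over lists: expansion along a row.

  private variable
    I J K : Set

  -- An alternating sum over the ways to single out one entry, with the other entries in order as
  -- second argument. Nested subtraction produces the signs, so no positions are counted.
  expand : (J → List J → Carrier) → List J → Carrier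
  expand f []       = 0#
  expand f (j ∷ js) = f j js - expand (λ j′ r → f j′ (j ∷ r)) js

  -- The value 0 on non-square input frees the permutation lemmas from length
  -- hypotheses.
  detᴸ : List (J → Carrier) → List J → Carrier
  detᴸ []       []      = 1#
  detᴸ []       (_ ∷ _) = 0#
  detᴸ (ρ ∷ ρs) js      = expand (λ j r → ρ j * detᴸ ρs r) js

  principal : (J → J → Carrier) → List J → Carrier
  principal M xs = detᴸ (map M xs) xs

  -- The restriction to entries of `js` serves rows that agree only on some columns; the length of
  -- the remainder serves `detᴸ-triangular`, whose induction needs square minors.
  expand-cong-All : ∀ {f g : J → List J → Carrier} {js} →
    All (λ j → ∀ r → suc (length r) ≡ length js → f j r ≈ g j r) js →
    expand f js ≈ expand g js
  expand-cong-All []       = ≈-refl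
  expand-cong-All (p ∷ ps) = +-cong (p _ ≡.refl)
    (-‿cong (expand-cong-All (All.map (λ q r e → q (_ ∷ r) (≡.cong suc e)) ps)))

  expand-cong : ∀ {f g : J → List J → Carrier} → (∀ j r → f j r ≈ g j r) →
    ∀ js → expand f js ≈ expand g js
  expand-cong p js = expand-cong-All (All.universal (λ j r _ → p j r) js)

  expand-zero : ∀ {f : J → List J → Carrier} {js} →
    All (λ j → ∀ r → f j r ≈ 0#) js → expand f js ≈ 0#
  expand-zero []       = ≈-refl
  expand-zero (p ∷ ps) = begin
    _ - _   ≈⟨ +-cong (p _) (-‿cong (expand-zero (All.map (λ q r → q (_ ∷ r)) ps))) ⟩
    0# - 0# ≈⟨ -‿inverseʳ 0# ⟩
    0#      ∎

  -‿+-interchange : ∀ a b c d → (a + b) - (c + d) ≈ (a - c) + (b - d)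
  -‿+-interchange a b c d = begin
    (a + b) - (c + d)     ≈⟨ +-congˡ (-‿+-comm c d) ⟨
    (a + b) + (- c - d)   ≈⟨ +-interchange a b (- c) (- d) ⟩
    (a - c) + (b - d)     ∎

  expand-+ : ∀ (f g : J → List J → Carrier) js →
    expand (λ j r → f j r + g j r) js ≈ expand f js + expand g js
  expand-+ f g []       = sym (+-identityˡ 0#)
  expand-+ f g (j ∷ js) = begin
    (f j js + g j js) - expand _ js                ≈⟨ +-congˡ (-‿cong (expand-+ _ _ js)) ⟩
    (f j js + g j js) - (expand _ js + expand _ js) ≈⟨ -‿+-interchange _ _ _ _ ⟩
    expand f (j ∷ js) + expand g (j ∷ js)           ∎

  expand-*ˡ : ∀ a (f : J → List J → Carrier) js →
    expand (λ j r → a * f j r) js ≈ a * expand f js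
  expand-*ˡ a f []       = sym (zeroʳ a)
  expand-*ˡ a f (j ∷ js) = begin
    a * f j js - expand _ js         ≈⟨ +-congˡ (-‿cong (expand-*ˡ a _ js)) ⟩
    a * f j js - a * expand _ js     ≈⟨ +-congˡ (-‿distribʳ-* _ _) ⟩
    a * f j js + a * (- expand _ js) ≈⟨ distribˡ a _ _ ⟨
    a * expand f (j ∷ js)            ∎

  expand-*ʳ : ∀ a (f : J → List J → Carrier) js →
    expand (λ j r → f j r * a) js ≈ expand f js * a
  expand-*ʳ a f js = begin
    expand (λ j r → f j r * a) js ≈⟨ expand-cong (λ _ _ → *-comm _ a) js ⟩
    expand (λ j r → a * f j r) js ≈⟨ expand-*ˡ a f js ⟩
    a * expand f js               ≈⟨ *-comm a _ ⟩
    expand f js * a               ∎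

  expand-‿- : ∀ (f g : J → List J → Carrier) js →
    expand (λ j r → f j r - g j r) js ≈ expand f js - expand g js
  expand-‿- f g []       = sym (-‿inverseʳ 0#)
  expand-‿- f g (j ∷ js) = begin
    (f j js - g j js) - expand _ js                   ≈⟨ +-congˡ (-‿cong (expand-‿- _ _ js)) ⟩
    (f j js - g j js) - (expand _ js - expand _ js)   ≈⟨ -‿+-interchange _ _ _ _ ⟩
    expand f (j ∷ js) + (- g j js - - expand _ js)    ≈⟨ +-congˡ (-‿+-comm _ _) ⟩
    expand f (j ∷ js) - expand g (j ∷ js)             ∎

  expand-map : ∀ (h : I → J) (f : J → List J → Carrier) is →
    expand f (map h is) ≡ expand (λ i r → f (h i) (map h r)) is
  expand-map h f []       = ≡.refl
  expand-map h f (i ∷ is) = ≡.cong (λ e → f (h i) (map h is) - e)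
    (expand-map h (λ j r → f j (h i ∷ r)) is)

  -- Terms that single out an entry of `ks` vanish, so `ks` survives intact at the end of every
  -- remainder.
  expand-++ : ∀ (f : J → List J → Carrier) js {ks} →
    All (λ k → ∀ r → f k r ≈ 0#) ks →
    expand f (js ++ ks) ≈ expand (λ j r → f j (r ++ ks)) js
  expand-++ f []       z = expand-zero z
  expand-++ f (j ∷ js) z =
    +-congˡ (-‿cong (expand-++ _ js (All.map (λ q r → q (j ∷ r)) z)))

  detᴸ-congᶜ : ∀ {ρs σs : List (J → Carrier)} →
    Pointwise (λ ρ σ → ∀ j → ρ j ≈ σ j) ρs σs → ∀ js → detᴸ ρs js ≈ detᴸ σs js
  detᴸ-congᶜ []       []      = ≈-refl
  detᴸ-congᶜ []       (_ ∷ _) = ≈-refl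
  detᴸ-congᶜ (p ∷ ps) js      = expand-cong (λ j r → *-cong (p j) (detᴸ-congᶜ ps r)) js

  detᴸ-map : ∀ (h : I → J) ρs is →
    detᴸ ρs (map h is) ≈ detᴸ (map (_∘ h) ρs) is
  detᴸ-map h []       []      = ≈-refl
  detᴸ-map h []       (_ ∷ _) = ≈-refl
  detᴸ-map h (ρ ∷ ρs) is      = begin
    expand _ (map h is)                             ≡⟨ expand-map h _ is ⟩
    expand (λ i r → ρ (h i) * detᴸ ρs (map h r)) is ≈⟨ expand-cong (λ _ r → *-congˡ (detᴸ-map h ρs r)) is ⟩
    expand _ is                                     ∎

  principal-map : ∀ (M : J → J → Carrier) (h : I → J) xs →
    principal M (map h xs) ≈ principal (λ x y → M (h x) (h y)) xs
  principal-map M h xs = begin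
    detᴸ (map M (map h xs)) (map h xs)          ≈⟨ detᴸ-map h (map M (map h xs)) xs ⟩
    detᴸ (map (_∘ h) (map M (map h xs))) xs     ≡⟨ ≡.cong (λ l → detᴸ l xs) (≡.trans (≡.sym (map-∘ (map h xs))) (≡.sym (map-∘ xs))) ⟩
    principal (λ x y → M (h x) (h y)) xs        ∎

  principal-cong : ∀ {M N : J → J → Carrier} → (∀ x y → M x y ≈ N x y) →
    ∀ xs → principal M xs ≈ principal N xs
  principal-cong {M = M} {N} p xs = detᴸ-congᶜ (rows xs) xs
    where
    rows : ∀ ys → Pointwise (λ ρ σ → ∀ j → ρ j ≈ σ j) (map M ys) (map N ys)
    rows []       = []
    rows (y ∷ ys) = p y ∷ rows ys

  principal-relabel : ∀ {M : J → J → Carrier} {N : K → K → Carrier} (g : I → J) (h : I → K) →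
    (∀ x y → M (g x) (g y) ≈ N (h x) (h y)) →
    ∀ xs → principal M (map g xs) ≈ principal N (map h xs)
  principal-relabel {M = M} {N} g h p xs = begin
    principal M (map g xs) ≈⟨ principal-map M g xs ⟩
    principal _ xs         ≈⟨ principal-cong p xs ⟩
    principal _ xs         ≈⟨ principal-map N h xs ⟨
    principal N (map h xs) ∎

  -- Signs of permutations; permuting rows and columns.

  sign : ∀ {xs ys : List J} → xs ↭ ys → Carrier
  sign refl         = 1#
  sign (prep _ p)   = sign p
  sign (swap _ _ p) = - sign p
  sign (trans p q)  = sign p * sign q

  -- The sign belongs to the derivation, since lists with repeated entries do not determine a
  -- permutation. This is harmless: rows and columns are always permuted by the same derivation, and
  -- only the square of its sign remains.
  sign² : ∀ {xs ys : List J} (p : xs ↭ ys) → sign p * sign p ≈ 1#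
  sign² refl         = *-identityˡ 1#
  sign² (prep _ p)   = sign² p
  sign² (swap _ _ p) = begin
    - sign p * - sign p     ≈⟨ -‿distribˡ-* _ _ ⟨
    - (sign p * - sign p)   ≈⟨ -‿cong (-‿distribʳ-* _ _) ⟨
    - - (sign p * sign p)   ≈⟨ -‿involutive _ ⟩
    sign p * sign p         ≈⟨ sign² p ⟩
    1#                      ∎
  sign² (trans p q) = begin
    (sign p * sign q) * (sign p * sign q) ≈⟨ *-interchange _ _ _ _ ⟩
    (sign p * sign p) * (sign q * sign q) ≈⟨ *-cong (sign² p) (sign² q) ⟩
    1# * 1#                               ≈⟨ *-identityˡ 1# ⟩
    1#                                    ∎

  -- The sign bookkeeping common to swapping two adjacent columns and to swapping two adjacent rows.
  exchange : ∀ a b {e e′} → e ≈ - e′ → a - (b - e) ≈ - (b - (a - e′))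
  exchange a b {e} {e′} e≈-e′ = begin
    a - (b - e)      ≈⟨ +-congˡ (-‿anti-homo-‿- b e) ⟩
    a + (e - b)      ≈⟨ +-assoc a e (- b) ⟨
    (a + e) - b      ≈⟨ +-congʳ (+-congˡ e≈-e′) ⟩
    (a - e′) - b     ≈⟨ -‿anti-homo-‿- b (a - e′) ⟨
    - (b - (a - e′)) ∎

  Signed : (List J → Carrier) → Set _
  Signed f = ∀ {xs ys} (p : xs ↭ ys) → f xs ≈ sign p * f ys

  *-sign-trans : ∀ {s t a b c} → a ≈ s * b → b ≈ t * c → a ≈ (s * t) * c
  *-sign-trans {s} {t} {a} {b} {c} p q = begin
    a           ≈⟨ p ⟩
    s * b       ≈⟨ *-congˡ q ⟩
    s * (t * c) ≈⟨ *-assoc s t c ⟨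
    (s * t) * c ∎

  *-distribˡ-‿- : ∀ s {a a′ b b′} → a ≈ s * a′ → b ≈ s * b′ → a - b ≈ s * (a′ - b′)
  *-distribˡ-‿- s {a} {a′} {b} {b′} p q = begin
    a - b               ≈⟨ +-cong p (-‿cong q) ⟩
    s * a′ - s * b′     ≈⟨ +-congˡ (-‿distribʳ-* s b′) ⟩
    s * a′ + s * (- b′) ≈⟨ distribˡ s a′ (- b′) ⟨
    s * (a′ - b′)       ∎

  -- For a swap of the first two entries, the two leading terms trade places and hence signs, while
  -- in every later term the swap happens inside the remainder, where `f j` itself alternates.
  expand-↭ : ∀ {f : J → List J → Carrier} → (∀ j → Signed (f j)) → Signed (expand f)
  expand-↭ alt refl        = sym (*-identityˡ _)
  expand-↭ alt (trans p q) = *-sign-trans (expand-↭ alt p) (expand-↭ alt q)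
  expand-↭ alt (prep x p)  =
    *-distribˡ-‿- (sign p) (alt x p) (expand-↭ (λ j q → alt j (prep x q)) p)
  expand-↭ {f = f} alt (swap {xs} {ys} x y p) = begin
    f x (y ∷ xs) - (f y (x ∷ xs) - expand fxy xs)
      ≈⟨ *-distribˡ-‿- (sign p) (alt x (prep y p))
           (*-distribˡ-‿- (sign p) (alt y (prep x p))
             (expand-↭ (λ j q → alt j (prep x (prep y q))) p)) ⟩
    sign p * (f x (y ∷ ys) - (f y (x ∷ ys) - expand fxy ys))
      ≈⟨ *-congˡ (exchange (f x (y ∷ ys)) (f y (x ∷ ys)) flip-prefix) ⟩
    sign p * - (f y (x ∷ ys) - (f x (y ∷ ys) - expand fyx ys))
      ≈⟨ -‿distribʳ-* _ _ ⟨
    - (sign p * expand f (y ∷ x ∷ ys))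
      ≈⟨ -‿distribˡ-* _ _ ⟩
    - sign p * expand f (y ∷ x ∷ ys) ∎
    where
    fxy fyx : _ → List _ → Carrier
    fxy j r = f j (x ∷ y ∷ r)
    fyx j r = f j (y ∷ x ∷ r)
    flip-prefix : expand fxy ys ≈ - expand fyx ys
    flip-prefix = begin
      expand fxy ys                        ≈⟨ expand-cong (λ j r → alt j (swap x y refl)) ys ⟩
      expand (λ j r → - 1# * fyx j r) ys   ≈⟨ expand-*ˡ (- 1#) fyx ys ⟩
      - 1# * expand fyx ys                 ≈⟨ -‿distribˡ-* _ _ ⟨
      - (1# * expand fyx ys)               ≈⟨ -‿cong (*-identityˡ _) ⟩
      - expand fyx ys                      ∎

  detᴸ-↭ᶜ : ∀ (ρs : List (J → Carrier)) → Signed (detᴸ ρs)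
  detᴸ-↭ᶜ []       refl         = sym (*-identityˡ _)
  detᴸ-↭ᶜ []       (prep _ _)   = sym (zeroʳ _)
  detᴸ-↭ᶜ []       (swap _ _ _) = sym (zeroʳ _)
  detᴸ-↭ᶜ []       (trans p q)  = *-sign-trans (detᴸ-↭ᶜ [] p) (detᴸ-↭ᶜ [] q)
  detᴸ-↭ᶜ (ρ ∷ ρs) p            = expand-↭ (λ j q → scaled j (detᴸ-↭ᶜ ρs q)) p
    where
    scaled : ∀ j {s a b} → a ≈ s * b → ρ j * a ≈ s * (ρ j * b)
    scaled j e = ≈-trans (*-congˡ e) (x*yz≈y*xz _ _ _)

  -- Both orders of singling out two entries leave the same remainder. Removing the earlier entry
  -- first shifts the later one by one position, which accounts for the sign.
  expand-expand : ∀ (H : J → J → List J → Carrier) js →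
    expand (λ j → expand (H j)) js ≈ - expand (λ j → expand (λ j′ → H j′ j)) js
  expand-expand H []       = sym -0#≈0#
  expand-expand H (x ∷ js) = begin
    expand (λ j → expand (H j)) (x ∷ js)
      ≈⟨ split H ⟩
    expand (H x) js - (expand (λ j → H j x) js - expand (λ j → expand (Hx j)) js)
      ≈⟨ exchange _ _ (expand-expand Hx js) ⟩
    - (expand (λ j → H j x) js - (expand (H x) js - expand (λ j → expand (λ j′ → Hx j′ j)) js))
      ≈⟨ -‿cong (split (λ j j′ → H j′ j)) ⟨
    - expand (λ j → expand (λ j′ → H j′ j)) (x ∷ js) ∎
    where
    Hx : _ → _ → List _ → Carrier
    Hx j j′ r = H j j′ (x ∷ r)
    -- The three terms are the choices with `x` taken first, with `x` taken second, and with `x` not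
    -- taken. Exchanging the arguments of `G` exchanges the first two.
    split : ∀ G → expand (λ j → expand (G j)) (x ∷ js) ≈
      expand (G x) js - (expand (λ j → G j x) js - expand (λ j → expand (λ j′ r → G j j′ (x ∷ r))) js)
    split G = +-congˡ (-‿cong (expand-‿- _ _ js))

  detᴸ-swapʳ : ∀ (ρ σ : J → Carrier) τs js →
    detᴸ (ρ ∷ σ ∷ τs) js ≈ - detᴸ (σ ∷ ρ ∷ τs) js
  detᴸ-swapʳ ρ σ τs js = begin
    detᴸ (ρ ∷ σ ∷ τs) js
      ≈⟨ expand-cong (λ j r → expand-*ˡ (ρ j) _ r) js ⟨
    expand (λ j → expand (λ j′ r → ρ j * (σ j′ * detᴸ τs r))) js
      ≈⟨ expand-expand _ js ⟩
    - expand (λ j → expand (λ j′ r → ρ j′ * (σ j * detᴸ τs r))) js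
      ≈⟨ -‿cong (expand-cong (λ j r → expand-cong (λ j′ r′ → x*yz≈y*xz _ _ _) r) js) ⟩
    - expand (λ j → expand (λ j′ r → σ j * (ρ j′ * detᴸ τs r))) js
      ≈⟨ -‿cong (expand-cong (λ j r → expand-*ˡ (σ j) _ r) js) ⟩
    - detᴸ (σ ∷ ρ ∷ τs) js ∎

  detᴸ-∷ : ∀ (ρ : J → Carrier) ρs σs s → (∀ js → detᴸ ρs js ≈ s * detᴸ σs js) →
    ∀ js → detᴸ (ρ ∷ ρs) js ≈ s * detᴸ (ρ ∷ σs) js
  detᴸ-∷ ρ ρs σs s e js = begin
    detᴸ (ρ ∷ ρs) js                            ≈⟨ expand-cong (λ j r → ≈-trans (*-congˡ (e r)) (x*yz≈y*xz _ _ _)) js ⟩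
    expand (λ j r → s * (ρ j * detᴸ σs r)) js   ≈⟨ expand-*ˡ s _ js ⟩
    s * detᴸ (ρ ∷ σs) js                        ∎

  detᴸ-↭ʳ : ∀ (M : I → J → Carrier) {xs ys} (p : xs ↭ ys) js →
    detᴸ (map M xs) js ≈ sign p * detᴸ (map M ys) js
  detᴸ-↭ʳ M refl        js = sym (*-identityˡ _)
  detᴸ-↭ʳ M (trans p q) js = *-sign-trans (detᴸ-↭ʳ M p js) (detᴸ-↭ʳ M q js)
  detᴸ-↭ʳ M (prep {xs} {ys} x p) js = detᴸ-∷ (M x) (map M xs) (map M ys) (sign p) (detᴸ-↭ʳ M p) js
  detᴸ-↭ʳ M (swap {xs} {ys} x y p) js = begin
    detᴸ (M x ∷ M y ∷ map M xs) js            ≈⟨ detᴸ-∷ (M x) (map M (y ∷ xs)) (map M (y ∷ ys)) (sign p)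
           (detᴸ-∷ (M y) (map M xs) (map M ys) (sign p) (detᴸ-↭ʳ M p)) js ⟩
    sign p * detᴸ (M x ∷ M y ∷ map M ys) js   ≈⟨ *-congˡ (detᴸ-swapʳ (M x) (M y) (map M ys) js) ⟩
    sign p * - detᴸ (M y ∷ M x ∷ map M ys) js ≈⟨ -‿distribʳ-* _ _ ⟨
    - (sign p * detᴸ (map M (y ∷ x ∷ ys)) js) ≈⟨ -‿distribˡ-* _ _ ⟩
    - sign p * detᴸ (map M (y ∷ x ∷ ys)) js   ∎

  *-sign² : ∀ {xs ys : List J} (p : xs ↭ ys) {a b c} →
    a ≈ sign p * b → b ≈ sign p * c → a ≈ c
  *-sign² p {a} {b} {c} q r = begin
    a                     ≈⟨ *-sign-trans q r ⟩
    (sign p * sign p) * c ≈⟨ *-congʳ (sign² p) ⟩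
    1# * c                ≈⟨ *-identityˡ c ⟩
    c                     ∎

  -- One derivation acts on the rows and then on the columns, and its two signs cancel. This makes
  -- the order of a vertex list irrelevant.
  principal-↭ : ∀ (M : J → J → Carrier) {xs ys} → xs ↭ ys → principal M xs ≈ principal M ys
  principal-↭ M {xs} {ys} p = *-sign² p (detᴸ-↭ʳ M p xs) (detᴸ-↭ᶜ (map M ys) p)

  -- Block triangular determinants and the coalescence formula.

  detᴸ-triangular : ∀ (ρs σs : List (J → Carrier)) js ks → length ρs ≡ length js →
    All (λ ρ → All (λ k → ρ k ≈ 0#) ks) ρs →
    detᴸ (ρs ++ σs) (js ++ ks) ≈ detᴸ ρs js * detᴸ σs ks
  detᴸ-triangular []       σs []       ks _  _       = sym (*-identityˡ _)
  detᴸ-triangular (ρ ∷ ρs) σs js       ks e (z ∷ zs) = begin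
    expand (λ j r → ρ j * detᴸ (ρs ++ σs) r) (js ++ ks)
      -- The first row picks a column of `js` only. By the length hypothesis `js` is exhausted
      -- together with `ρs`, which leaves `σs` facing exactly `ks`.
      ≈⟨ expand-++ _ js (All.map (λ q r → ≈-trans (*-congʳ q) (zeroˡ _)) z) ⟩
    expand (λ j r → ρ j * detᴸ (ρs ++ σs) (r ++ ks)) js
      ≈⟨ expand-cong-All (All.universal (λ j r e′ → ≈-trans
           (*-congˡ (detᴸ-triangular ρs σs r ks (ℕₚ.suc-injective (≡.trans e (≡.sym e′))) zs))
           (sym (*-assoc _ _ _))) js) ⟩
    expand (λ j r → (ρ j * detᴸ ρs r) * detᴸ σs ks) js
      ≈⟨ expand-*ʳ _ _ js ⟩
    detᴸ (ρ ∷ ρs) js * detᴸ σs ks ∎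

  ZeroBlock : (J → J → Carrier) → List J → List J → Set _
  ZeroBlock M xs ys = All (λ x → All (λ y → M x y ≈ 0#) ys) xs

  principal-++ : ∀ (M : J → J → Carrier) xs ys → ZeroBlock M xs ys →
    principal M (xs ++ ys) ≈ principal M xs * principal M ys
  principal-++ M xs ys z = begin
    detᴸ (map M (xs ++ ys)) (xs ++ ys)      ≡⟨ ≡.cong (λ l → detᴸ l (xs ++ ys)) (map-++ M xs ys) ⟩
    detᴸ (map M xs ++ map M ys) (xs ++ ys)  ≈⟨ detᴸ-triangular (map M xs) (map M ys) xs ys (length-map M xs) (All.map⁺ z) ⟩
    principal M xs * principal M ys         ∎

  -- Splitting row v as its part α on v ∷ xs plus its part β on ys makes both
  -- summands block triangular.
  principal-coalesce : ∀ (M : J → J → Carrier) v xs ys (α β : J → Carrier) →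
    (∀ j → M v j ≈ α j + β j) →
    All (λ y → α y ≈ 0#) ys → All (λ x → β x ≈ 0#) (v ∷ xs) →
    ZeroBlock M xs ys → ZeroBlock M ys xs →
    principal M (v ∷ xs ++ ys) ≈
      principal M (v ∷ xs) * principal M ys +
      principal M xs * (principal M (v ∷ ys) - M v v * principal M ys)
  principal-coalesce M v xs ys α β split α-zero (βv≈0 ∷ β-zero) xs-ys ys-xs = begin
    expand (λ j r → M v j * d r) (v ∷ xs ++ ys)
      ≈⟨ expand-cong (λ j r → ≈-trans (*-congʳ (split j)) (distribʳ (d r) (α j) (β j))) (v ∷ xs ++ ys) ⟩
    expand (λ j r → α j * d r + β j * d r) (v ∷ xs ++ ys)
      ≈⟨ expand-+ (λ j r → α j * d r) (λ j r → β j * d r) (v ∷ xs ++ ys) ⟩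
    detᴸ (α ∷ map M (xs ++ ys)) (v ∷ xs ++ ys) + detᴸ (β ∷ map M (xs ++ ys)) (v ∷ xs ++ ys)
      ≈⟨ +-cong α-part β-part ⟩
    principal M (v ∷ xs) * principal M ys +
      principal M xs * (principal M (v ∷ ys) - M v v * principal M ys) ∎
    where
    d : List _ → Carrier
    d = detᴸ (map M (xs ++ ys))

    α≈M : All (λ j → ∀ r → suc (length r) ≡ length (v ∷ xs) →
            α j * detᴸ (map M xs) r ≈ M v j * detᴸ (map M xs) r) (v ∷ xs)
    α≈M = All.map (λ {j} βj≈0 r _ → *-congʳ (begin
      α j       ≈⟨ +-identityʳ (α j) ⟨
      α j + 0#  ≈⟨ +-congˡ βj≈0 ⟨
      α j + β j ≈⟨ split j ⟨
      M v j     ∎)) (βv≈0 ∷ β-zero)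

    α-part : detᴸ (α ∷ map M (xs ++ ys)) (v ∷ xs ++ ys) ≈ principal M (v ∷ xs) * principal M ys
    α-part = begin
      detᴸ (α ∷ map M (xs ++ ys)) (v ∷ xs ++ ys)
        ≡⟨ ≡.cong (λ l → detᴸ (α ∷ l) (v ∷ xs ++ ys)) (map-++ M xs ys) ⟩
      detᴸ ((α ∷ map M xs) ++ map M ys) ((v ∷ xs) ++ ys)
        ≈⟨ detᴸ-triangular (α ∷ map M xs) (map M ys) (v ∷ xs) ys
             (≡.cong suc (length-map M xs)) (α-zero ∷ All.map⁺ xs-ys) ⟩
      detᴸ (α ∷ map M xs) (v ∷ xs) * principal M ys
        ≈⟨ *-congʳ (expand-cong-All α≈M) ⟩
      principal M (v ∷ xs) * principal M ys ∎

    -- On `v ∷ ys` the row `β` is row `v` with its diagonal entry replaced by 0, since `α` already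
    -- contains that entry. Subtracting its cofactor term compensates.
    bordered : detᴸ (β ∷ map M ys) (v ∷ ys) ≈ principal M (v ∷ ys) - M v v * principal M ys
    bordered = begin
      β v * principal M ys - expand (λ j r → β j * detᴸ (map M ys) (v ∷ r)) ys
        ≈⟨ +-cong (≈-trans (*-congʳ βv≈0) (zeroˡ _)) (-‿cong (expand-cong-All (All.map (λ {j} αj≈0 r _ → *-congʳ (begin
             β j       ≈⟨ +-identityˡ (β j) ⟨
             0# + β j  ≈⟨ +-congʳ αj≈0 ⟨
             α j + β j ≈⟨ split j ⟨
             M v j     ∎)) α-zero))) ⟩
      0# - E                                          ≈⟨ +-congʳ (-‿inverseʳ _) ⟨
      (M v v * P - M v v * P) - E                     ≈⟨ +-assoc _ _ _ ⟩
      M v v * P + (- (M v v * P) - E)                 ≈⟨ +-congˡ (+-comm _ _) ⟩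
      M v v * P + (- E - M v v * P)                   ≈⟨ +-assoc _ _ _ ⟨
      (M v v * P - E) - M v v * P                     ∎
      where
      P E : Carrier
      P = principal M ys
      E = expand (λ j r → M v j * detᴸ (map M ys) (v ∷ r)) ys

    β-part : detᴸ (β ∷ map M (xs ++ ys)) (v ∷ xs ++ ys) ≈
             principal M xs * (principal M (v ∷ ys) - M v v * principal M ys)
    β-part = begin
      detᴸ (β ∷ map M (xs ++ ys)) (v ∷ xs ++ ys)
        -- Row `β` is supported on `ys`, so `ys` has to stand next to `v` for the matrix to be block
        -- triangular. Rows and columns are reordered alike, with equal signs.
        ≈⟨ *-sign² (↭.++-comm xs ys)
             (detᴸ-∷ β (map M (xs ++ ys)) (map M (ys ++ xs)) (sign (↭.++-comm xs ys)) (detᴸ-↭ʳ M (↭.++-comm xs ys)) (v ∷ xs ++ ys))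
             (detᴸ-↭ᶜ (β ∷ map M (ys ++ xs)) (prep v (↭.++-comm xs ys))) ⟩
      detᴸ (β ∷ map M (ys ++ xs)) (v ∷ ys ++ xs)
        ≡⟨ ≡.cong (λ l → detᴸ (β ∷ l) (v ∷ ys ++ xs)) (map-++ M ys xs) ⟩
      detᴸ ((β ∷ map M ys) ++ map M xs) ((v ∷ ys) ++ xs)
        ≈⟨ detᴸ-triangular (β ∷ map M ys) (map M xs) (v ∷ ys) xs
             (≡.cong suc (length-map M ys)) (β-zero ∷ All.map⁺ ys-xs) ⟩
      detᴸ (β ∷ map M ys) (v ∷ ys) * principal M xs
        ≈⟨ *-comm _ _ ⟩
      principal M xs * detᴸ (β ∷ map M ys) (v ∷ ys)
        ≈⟨ *-congˡ bordered ⟩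
      principal M xs * (principal M (v ∷ ys) - M v v * principal M ys) ∎

-- Coefficient lists form a commutative ring.

module PolynomialRing where
  -- A record, unlike _≈P_, lets Agda infer the polynomials from an equation.
  infix 4 _≋_
  record _≋_ (p q : Poly) : Set where
    constructor mk≋
    field coeffs : p ≈P q
  open _≋_

  ≋-isEquivalence : IsEquivalence _≋_
  ≋-isEquivalence = record
    { refl  = mk≋ λ _ → ≡.refl
    ; sym   = λ p → mk≋ λ i → ≡.sym (coeffs p i)
    ; trans = λ p q → mk≋ λ i → ≡.trans (coeffs p i) (coeffs q i)
    }

  open IsEquivalence ≋-isEquivalence using () renaming (refl to ≋-refl; sym to ≋-sym; trans to ≋-trans)

  coeff-+P : ∀ p q i → coeff (p +P q) i ≡ coeff p i ℤ.+ coeff q i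
  coeff-+P []      q       i       = ≡.sym (ℤₚ.+-identityˡ _)
  coeff-+P (a ∷ p) []      i       = ≡.sym (ℤₚ.+-identityʳ _)
  coeff-+P (a ∷ p) (b ∷ q) zero    = ≡.refl
  coeff-+P (a ∷ p) (b ∷ q) (suc i) = coeff-+P p q i

  coeff-scaleP : ∀ c p i → coeff (scaleP c p) i ≡ c ℤ.* coeff p i
  coeff-scaleP c []      i       = ≡.sym (ℤₚ.*-zeroʳ c)
  coeff-scaleP c (a ∷ p) zero    = ≡.refl
  coeff-scaleP c (a ∷ p) (suc i) = coeff-scaleP c p i

  +P-cong : ∀ {p p′ q q′} → p ≋ p′ → q ≋ q′ → p +P q ≋ p′ +P q′
  +P-cong {p} {p′} {q} {q′} e f = mk≋ λ i → begin
    coeff (p +P q) i           ≡⟨ coeff-+P p q i ⟩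
    coeff p i ℤ.+ coeff q i    ≡⟨ cong₂ ℤ._+_ (coeffs e i) (coeffs f i) ⟩
    coeff p′ i ℤ.+ coeff q′ i  ≡⟨ coeff-+P p′ q′ i ⟨
    coeff (p′ +P q′) i         ∎
    where open ≡.≡-Reasoning

  +P-assoc : ∀ p q r → (p +P q) +P r ≋ p +P (q +P r)
  +P-assoc p q r = mk≋ λ i → begin
    coeff (p +P q +P r) i                       ≡⟨ coeff-+P (p +P q) r i ⟩
    coeff (p +P q) i ℤ.+ coeff r i              ≡⟨ cong (ℤ._+ coeff r i) (coeff-+P p q i) ⟩
    coeff p i ℤ.+ coeff q i ℤ.+ coeff r i       ≡⟨ ℤₚ.+-assoc (coeff p i) (coeff q i) (coeff r i) ⟩
    coeff p i ℤ.+ (coeff q i ℤ.+ coeff r i)     ≡⟨ cong (λ z → coeff p i ℤ.+ z) (coeff-+P q r i) ⟨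
    coeff p i ℤ.+ coeff (q +P r) i              ≡⟨ coeff-+P p (q +P r) i ⟨
    coeff (p +P (q +P r)) i                     ∎
    where open ≡.≡-Reasoning

  +P-comm : ∀ p q → p +P q ≋ q +P p
  +P-comm p q = mk≋ λ i → begin
    coeff (p +P q) i        ≡⟨ coeff-+P p q i ⟩
    coeff p i ℤ.+ coeff q i ≡⟨ ℤₚ.+-comm (coeff p i) (coeff q i) ⟩
    coeff q i ℤ.+ coeff p i ≡⟨ coeff-+P q p i ⟨
    coeff (q +P p) i        ∎
    where open ≡.≡-Reasoning

  +P-identityʳ : ∀ p → p +P [] ≋ p
  +P-identityʳ p = +P-comm p []

  scaleP-cong : ∀ c {p q} → p ≋ q → scaleP c p ≋ scaleP c q
  scaleP-cong c {p} {q} e = mk≋ λ i → begin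
    coeff (scaleP c p) i ≡⟨ coeff-scaleP c p i ⟩
    c ℤ.* coeff p i      ≡⟨ cong (c ℤ.*_) (coeffs e i) ⟩
    c ℤ.* coeff q i      ≡⟨ coeff-scaleP c q i ⟨
    coeff (scaleP c q) i ∎
    where open ≡.≡-Reasoning

  scaleP-+P : ∀ c p q → scaleP c (p +P q) ≋ scaleP c p +P scaleP c q
  scaleP-+P c p q = mk≋ λ i → begin
    coeff (scaleP c (p +P q)) i                   ≡⟨ coeff-scaleP c (p +P q) i ⟩
    c ℤ.* coeff (p +P q) i                        ≡⟨ cong (c ℤ.*_) (coeff-+P p q i) ⟩
    c ℤ.* (coeff p i ℤ.+ coeff q i)               ≡⟨ ℤₚ.*-distribˡ-+ c (coeff p i) (coeff q i) ⟩
    c ℤ.* coeff p i ℤ.+ c ℤ.* coeff q i           ≡⟨ cong₂ ℤ._+_ (coeff-scaleP c p i) (coeff-scaleP c q i) ⟨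
    coeff (scaleP c p) i ℤ.+ coeff (scaleP c q) i ≡⟨ coeff-+P (scaleP c p) (scaleP c q) i ⟨
    coeff (scaleP c p +P scaleP c q) i            ∎
    where open ≡.≡-Reasoning

  scaleP-scaleP : ∀ c d p → scaleP (c ℤ.* d) p ≋ scaleP c (scaleP d p)
  scaleP-scaleP c d p = mk≋ λ i → begin
    coeff (scaleP (c ℤ.* d) p) i    ≡⟨ coeff-scaleP (c ℤ.* d) p i ⟩
    c ℤ.* d ℤ.* coeff p i           ≡⟨ ℤₚ.*-assoc c d (coeff p i) ⟩
    c ℤ.* (d ℤ.* coeff p i)         ≡⟨ cong (c ℤ.*_) (coeff-scaleP d p i) ⟨
    c ℤ.* coeff (scaleP d p) i      ≡⟨ coeff-scaleP c (scaleP d p) i ⟨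
    coeff (scaleP c (scaleP d p)) i ∎
    where open ≡.≡-Reasoning

  scaleP-1 : ∀ p → scaleP 1ℤ p ≋ p
  scaleP-1 p = mk≋ λ i → ≡.trans (coeff-scaleP 1ℤ p i) (ℤₚ.*-identityˡ _)

  scaleP-0 : ∀ p → scaleP 0ℤ p ≋ []
  scaleP-0 p = mk≋ λ i → ≡.trans (coeff-scaleP 0ℤ p i) (ℤₚ.*-zeroˡ (coeff p i))

  -P-inverseˡ : ∀ p → negP p +P p ≋ []
  -P-inverseˡ p = mk≋ λ i → begin
    coeff (negP p +P p) i                ≡⟨ coeff-+P (negP p) p i ⟩
    coeff (negP p) i ℤ.+ coeff p i       ≡⟨ cong (ℤ._+ coeff p i) (coeff-scaleP (ℤ.- 1ℤ) p i) ⟩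
    ℤ.- 1ℤ ℤ.* coeff p i ℤ.+ coeff p i   ≡⟨ cong (ℤ._+ coeff p i) (ℤₚ.-1*i≡-i (coeff p i)) ⟩
    ℤ.- coeff p i ℤ.+ coeff p i          ≡⟨ ℤₚ.+-inverseˡ (coeff p i) ⟩
    0ℤ                                   ∎
    where open ≡.≡-Reasoning

  ∷-cong : ∀ {a b p q} → a ≡ b → p ≋ q → a ∷ p ≋ b ∷ q
  ∷-cong a≡b e = mk≋ λ { zero → a≡b ; (suc i) → coeffs e i }

  0∷[] : 0ℤ ∷ [] ≋ []
  0∷[] = mk≋ λ { zero → ≡.refl ; (suc _) → ≡.refl }

  open import Algebra.Structures {A = Poly} _≋_

  +P-isCommutativeMonoid : IsCommutativeMonoid _+P_ []
  +P-isCommutativeMonoid = record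
    { isMonoid = record
      { isSemigroup = record
        { isMagma = record { isEquivalence = ≋-isEquivalence ; ∙-cong = +P-cong }
        ; assoc   = +P-assoc
        }
      ; identity = (λ _ → ≋-refl) , +P-identityʳ
      }
    ; comm = +P-comm
    }

  private
    module +P where
      commutativeMonoid : CommutativeMonoid 0ℓ 0ℓ
      commutativeMonoid = record { isCommutativeMonoid = +P-isCommutativeMonoid }
      open CommutativeMonoid commutativeMonoid public using (setoid; commutativeSemigroup)
      open import Algebra.Properties.CommutativeSemigroup commutativeSemigroup public
        using (interchange; x∙yz≈y∙xz)

  open SetoidReasoning +P.setoid

  *P-congˡ : ∀ p {q q′} → q ≋ q′ → p *P q ≋ p *P q′
  *P-congˡ []      e = ≋-refl
  *P-congˡ (a ∷ p) e = +P-cong (scaleP-cong a e) (∷-cong ≡.refl (*P-congˡ p e))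

  *P-zeroʳ : ∀ p → p *P [] ≋ []
  *P-zeroʳ []      = ≋-refl
  *P-zeroʳ (a ∷ p) = ≋-trans (∷-cong ≡.refl (*P-zeroʳ p)) 0∷[]

  -- The mirror image of the defining clause of `*P`. It yields commutativity, from which the
  -- right-hand congruence and distributivity follow.
  *P-∷ : ∀ p b q → p *P (b ∷ q) ≋ scaleP b p +P (0ℤ ∷ p *P q)
  *P-∷ []      b q = ≋-sym 0∷[]
  *P-∷ (a ∷ p) b q = ∷-cong (cong (ℤ._+ 0ℤ) (ℤₚ.*-comm a b)) (begin
    scaleP a q +P p *P (b ∷ q)                   ≈⟨ +P-cong ≋-refl (*P-∷ p b q) ⟩
    scaleP a q +P (scaleP b p +P (0ℤ ∷ p *P q))  ≈⟨ +P.x∙yz≈y∙xz (scaleP a q) (scaleP b p) (0ℤ ∷ p *P q) ⟩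
    scaleP b p +P (scaleP a q +P (0ℤ ∷ p *P q))  ∎)

  *P-comm : ∀ p q → p *P q ≋ q *P p
  *P-comm []      q = ≋-sym (*P-zeroʳ q)
  *P-comm (a ∷ p) q = begin
    scaleP a q +P (0ℤ ∷ p *P q) ≈⟨ +P-cong ≋-refl (∷-cong ≡.refl (*P-comm p q)) ⟩
    scaleP a q +P (0ℤ ∷ q *P p) ≈⟨ *P-∷ q a p ⟨
    q *P (a ∷ p)                ∎

  *P-distribˡ : ∀ p q r → p *P (q +P r) ≋ p *P q +P p *P r
  *P-distribˡ []      q r = ≋-refl
  *P-distribˡ (a ∷ p) q r = begin
    scaleP a (q +P r) +P (0ℤ ∷ p *P (q +P r))
      ≈⟨ +P-cong (scaleP-+P a q r) (∷-cong ≡.refl (*P-distribˡ p q r)) ⟩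
    (scaleP a q +P scaleP a r) +P ((0ℤ ∷ p *P q) +P (0ℤ ∷ p *P r))
      ≈⟨ +P.interchange (scaleP a q) (scaleP a r) (0ℤ ∷ p *P q) (0ℤ ∷ p *P r) ⟩
    (a ∷ p) *P q +P (a ∷ p) *P r ∎

  *P-congʳ : ∀ p {q q′} → q ≋ q′ → q *P p ≋ q′ *P p
  *P-congʳ p {q} {q′} e = ≋-trans (*P-comm q p) (≋-trans (*P-congˡ p e) (*P-comm p q′))

  *P-distribʳ : ∀ p q r → (q +P r) *P p ≋ q *P p +P r *P p
  *P-distribʳ p q r = begin
    (q +P r) *P p    ≈⟨ *P-comm (q +P r) p ⟩
    p *P (q +P r)    ≈⟨ *P-distribˡ p q r ⟩
    p *P q +P p *P r ≈⟨ +P-cong (*P-comm p q) (*P-comm p r) ⟩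
    q *P p +P r *P p ∎

  scaleP-*P : ∀ c p q → scaleP c p *P q ≋ scaleP c (p *P q)
  scaleP-*P c []      q = ≋-refl
  scaleP-*P c (a ∷ p) q = begin
    scaleP (c ℤ.* a) q +P (0ℤ ∷ scaleP c p *P q)
      ≈⟨ +P-cong (scaleP-scaleP c a q) (∷-cong (≡.sym (ℤₚ.*-zeroʳ c)) (scaleP-*P c p q)) ⟩
    scaleP c (scaleP a q) +P scaleP c (0ℤ ∷ p *P q)
      ≈⟨ scaleP-+P c (scaleP a q) (0ℤ ∷ p *P q) ⟨
    scaleP c ((a ∷ p) *P q) ∎

  0∷-*P : ∀ p q → (0ℤ ∷ p) *P q ≋ 0ℤ ∷ p *P q
  0∷-*P p q = +P-cong (scaleP-0 q) ≋-refl

  *P-assoc : ∀ p q r → (p *P q) *P r ≋ p *P (q *P r)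
  *P-assoc []      q r = ≋-refl
  *P-assoc (a ∷ p) q r = begin
    (scaleP a q +P (0ℤ ∷ p *P q)) *P r        ≈⟨ *P-distribʳ r (scaleP a q) (0ℤ ∷ p *P q) ⟩
    scaleP a q *P r +P (0ℤ ∷ p *P q) *P r     ≈⟨ +P-cong (scaleP-*P a q r) (0∷-*P (p *P q) r) ⟩
    scaleP a (q *P r) +P (0ℤ ∷ (p *P q) *P r) ≈⟨ +P-cong ≋-refl (∷-cong ≡.refl (*P-assoc p q r)) ⟩
    (a ∷ p) *P (q *P r)                       ∎

  *P-identityˡ : ∀ p → constP 1ℤ *P p ≋ p
  *P-identityˡ p = begin
    scaleP 1ℤ p +P (0ℤ ∷ []) ≈⟨ +P-cong (scaleP-1 p) 0∷[] ⟩
    p +P []                  ≈⟨ +P-identityʳ p ⟩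
    p                        ∎

  polyRing : CommutativeRing 0ℓ 0ℓ
  polyRing = record
    { Carrier = Poly ; _≈_ = _≋_ ; _+_ = _+P_ ; _*_ = _*P_ ; -_ = negP ; 0# = [] ; 1# = constP 1ℤ
    ; isCommutativeRing = record
      { isRing = record
        { +-isAbelianGroup = record
          { isGroup = record
            { isMonoid = IsCommutativeMonoid.isMonoid +P-isCommutativeMonoid
            ; inverse  = -P-inverseˡ , λ p → ≋-trans (+P-comm p (negP p)) (-P-inverseˡ p)
            ; ⁻¹-cong  = scaleP-cong (ℤ.- 1ℤ)
            }
          ; comm = +P-comm
          }
        ; *-cong     = λ {p} {p′} {q} {q′} e f → ≋-trans (*P-congʳ q e) (*P-congˡ p′ f)
        ; *-assoc    = *P-assoc
        ; *-identity = *P-identityˡ , λ p → ≋-trans (*P-comm p (constP 1ℤ)) (*P-identityˡ p)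
        ; distrib    = *P-distribˡ , *P-distribʳ
        }
      ; *-comm = *P-comm
      }
    }

open PolynomialRing
open ListDeterminant polyRing
open ≡ using (refl; sym; trans)
open import Data.Nat using (_+_; _*_; _∸_; _≤_; _<_)
open ℕₚ

private variable
  A B : Set

⌊⌋-⇔ : (A → B) → (B → A) → (a? : Dec A) (b? : Dec B) → ⌊ a? ⌋ ≡ ⌊ b? ⌋
⌊⌋-⇔ f g (yes _) (yes _) = refl
⌊⌋-⇔ f g (yes a) (no ¬b) = ⊥-elim (¬b (f a))
⌊⌋-⇔ f g (no ¬a) (yes b) = ⊥-elim (¬a (g b))
⌊⌋-⇔ f g (no _)  (no _)  = refl

⌊⌋-true : A → (a? : Dec A) → ⌊ a? ⌋ ≡ true
⌊⌋-true a (yes _) = refl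
⌊⌋-true a (no ¬a) = ⊥-elim (¬a a)

⌊⌋-false : ¬ A → (a? : Dec A) → ⌊ a? ⌋ ≡ false
⌊⌋-false ¬a (yes a) = ⊥-elim (¬a a)
⌊⌋-false ¬a (no _)  = refl

-- The determinant over `Fin` as a determinant over lists.

altSum-cong : ∀ {n} {f g : Fin n → Poly} → (∀ j → f j ≡ g j) → altSum f ≡ altSum g
altSum-cong {zero}  e = refl
altSum-cong {suc n} e = cong₂ (λ p q → p +P negP q) (e zero) (altSum-cong (e ∘ suc))

-- `punchIn j` enumerates the indices other than `j` in order, which is the remainder that `expand`
-- passes on; the signs are nested alike in `altSum`.
expand-tabulate : ∀ n (F : A → List A → Poly) (f : Fin (suc n) → A) →
  expand F (tabulate f) ≡ altSum (λ j → F (f j) (tabulate (f ∘ punchIn j)))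
expand-tabulate zero    F f = refl
expand-tabulate (suc n) F f = cong (λ e → F (f zero) (tabulate (f ∘ suc)) +P negP e)
  (expand-tabulate n (λ j r → F j (f zero ∷ r)) (f ∘ suc))

det≡detᴸ : ∀ n (E : Fin n → Fin n → Poly) (ρ : Fin n → A → Poly) (f : Fin n → A) →
  (∀ i j → E i j ≡ ρ i (f j)) → det n E ≡ detᴸ (tabulate ρ) (tabulate f)
det≡detᴸ zero    E ρ f e = refl
det≡detᴸ (suc n) E ρ f e = trans
  (altSum-cong λ j → cong₂ _*P_ (e zero j)
    (det≡detᴸ n _ (ρ ∘ suc) (f ∘ punchIn j) (λ i k → e (suc i) (punchIn j k))))
  (sym (expand-tabulate n (λ j r → ρ zero j *P detᴸ (tabulate (ρ ∘ suc)) r) f))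

det≡principal : ∀ n (E : Fin n → Fin n → Poly) (M : A → A → Poly) (f : Fin n → A) →
  (∀ i j → E i j ≡ M (f i) (f j)) → det n E ≡ principal M (tabulate f)
det≡principal n E M f e = trans (det≡detᴸ n E (M ∘ f) f e)
  (cong (λ l → detᴸ l (tabulate f)) (sym (map-tabulate f M)))

-- Kept literally in the shape used by `charPoly`, so that matrices can be compared through their
-- two Boolean tests alone.
entry : Bool → Bool → Poly
entry e b = (if e then varP else []) +P negP (constP (b2ℤ b))

entry-zero : ∀ {e b} → e ≡ false → b ≡ false → entry e b ≋ []
entry-zero refl refl = 0∷[]

-- Enumerating sums, products and initial segments as lists.

applyUpTo-+ : ∀ (f : ℕ → A) m n →
  applyUpTo f (m + n) ≡ applyUpTo f m ++ applyUpTo (f ∘ (m +_)) n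
applyUpTo-+ f zero    n = refl
applyUpTo-+ f (suc m) n = cong (f zero ∷_) (applyUpTo-+ (f ∘ suc) m n)

upTo-+ : ∀ m n → upTo (m + n) ≡ upTo m ++ map (m +_) (upTo n)
upTo-+ m n = trans (applyUpTo-+ id m n) (cong (upTo m ++_) (sym (map-upTo (m +_) n)))

upTo-+-suc : ∀ m n → upTo (m + suc n) ≡ upTo m ++ m ∷ map (suc m +_) (upTo n)
upTo-+-suc m n = begin
  upTo (m + suc n)                                      ≡⟨ applyUpTo-+ id m (suc n) ⟩
  upTo m ++ (m + 0) ∷ applyUpTo (λ i → m + suc i) n     ≡⟨ cong (λ l → upTo m ++ (m + 0) ∷ l) (map-upTo _ n) ⟨
  upTo m ++ (m + 0) ∷ map (λ i → m + suc i) (upTo n)    ≡⟨ cong₂ (λ z l → upTo m ++ z ∷ l) (+-identityʳ m) (map-cong (+-suc m) (upTo n)) ⟩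
  upTo m ++ m ∷ map (suc m +_) (upTo n)                 ∎
  where open ≡.≡-Reasoning

tabulate-splitAt : ∀ m n (f : Fin m ⊎ Fin n → A) →
  tabulate (f ∘ splitAt m) ≡ tabulate (f ∘ inj₁) ++ tabulate (f ∘ inj₂)
tabulate-splitAt zero    n f = refl
tabulate-splitAt (suc m) n f = cong (f (inj₁ zero) ∷_) (tabulate-splitAt m n (f ∘ Sum.map₁ suc))

tabulate-remQuot : ∀ m n (f : Fin m × Fin n → A) →
  tabulate (f ∘ remQuot {m} n) ≡ concat (tabulate λ i → tabulate λ j → f (i , j))
tabulate-remQuot zero    n f = refl
tabulate-remQuot (suc m) n f = trans
  -- After `splitAt n`, this composite is what `f ∘ remQuot` unfolds to at `suc m`.
  (tabulate-splitAt n (m * n) (f ∘ Product.swap ∘ Sum.[ (λ j → j , zero) , Product.map₂ suc ∘ Fin.quotRem {m} n ]))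
  (cong (tabulate (λ j → f (zero , j)) ++_) (tabulate-remQuot m n (f ∘ Product.map₁ suc)))

tabulate-toℕ : ∀ n (f : ℕ → A) → tabulate {n = n} (f ∘ toℕ) ≡ map f (upTo n)
tabulate-toℕ zero    f = refl
tabulate-toℕ (suc n) f = cong (f zero ∷_) (begin
  tabulate (f ∘ suc ∘ toℕ)       ≡⟨ tabulate-toℕ n (f ∘ suc) ⟩
  map (f ∘ suc) (upTo n)         ≡⟨ map-upTo (f ∘ suc) n ⟩
  applyUpTo (f ∘ suc) n          ≡⟨ cong (drop 1) (map-upTo f (suc n)) ⟨
  map f (applyUpTo suc n)        ∎)
  where open ≡.≡-Reasoning

remQuot-injective : ∀ m n {s t : Fin (m * n)} → remQuot {m} n s ≡ remQuot n t → s ≡ t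
remQuot-injective m n {s} {t} e = begin
  s                                         ≡⟨ Fin.combine-remQuot {m} n s ⟨
  Product.uncurry combine (remQuot {m} n s) ≡⟨ cong (Product.uncurry combine) e ⟩
  Product.uncurry combine (remQuot {m} n t) ≡⟨ Fin.combine-remQuot {m} n t ⟩
  t                                         ∎
  where open ≡.≡-Reasoning

splitAt-injective : ∀ m n {s t : Fin (m + n)} → splitAt m s ≡ splitAt m t → s ≡ t
splitAt-injective m n {s} {t} e = begin
  s                      ≡⟨ Fin.join-splitAt m n s ⟨
  join m n (splitAt m s) ≡⟨ cong (join m n) e ⟩
  join m n (splitAt m t) ≡⟨ Fin.join-splitAt m n t ⟩
  t                      ∎
  where open ≡.≡-Reasoning

-- The coalescence on labelled vertices.

module Coalescence (d′ p : ℕ) (a : Fin p → ℕ) (a<d : ∀ j → a j < suc d′) (G : RootedGraph) where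
  open RootedGraph G using (adj; root) renaming (n to g)

  d q : ℕ
  d = suc d′
  q = pred g

  -- Path positions and block indices are unbounded naturals, so that segments of every length and
  -- all their translates share one type and one matrix.
  Base Vertex : Set
  Base   = ℕ ⊎ ((ℕ × Fin p) × Fin q)
  Vertex = ℕ ⊎ (Maybe (ℕ × Fin p) × Fin q)

  -- A copy of G is tagged by the indices (i , j) of its attachment point,
  -- or by nothing if it hangs at the extra attachment point c.
  lift : Base → Vertex
  lift = Sum.map₂ (Product.map₁ just)

  extra : Fin q → Vertex
  extra l = inj₂ (nothing , l)

  _≟ᵀ_ : DecidableEquality (Maybe (ℕ × Fin p))
  _≟ᵀ_ = Maybe.≡-dec (Product.≡-dec ℕ._≟_ Fin._≟_)

  _≟ⱽ_ : DecidableEquality Vertex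
  _≟ⱽ_ = Sum.≡-dec ℕ._≟_ (Product.≡-dec _≟ᵀ_ Fin._≟_)

  position : ℕ → Maybe (ℕ × Fin p) → ℕ
  position c nothing        = c
  position c (just (i , j)) = i * d + a j

  adjacent : ℕ → Vertex → Vertex → Bool
  adjacent c (inj₁ t)       (inj₁ t′)        = ⌊ suc t ℕ.≟ t′ ⌋ ∨ ⌊ suc t′ ℕ.≟ t ⌋
  adjacent c (inj₁ t)       (inj₂ (τ , l))   = ⌊ t ℕ.≟ position c τ ⌋ ∧ adj root (nonRoot root l)
  adjacent c (inj₂ (τ , l)) (inj₁ t)         = ⌊ t ℕ.≟ position c τ ⌋ ∧ adj (nonRoot root l) root
  adjacent c (inj₂ (τ , l)) (inj₂ (τ′ , l′)) = ⌊ τ ≟ᵀ τ′ ⌋ ∧ adj (nonRoot root l) (nonRoot root l′)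

  charMatrix : ℕ → Vertex → Vertex → Poly
  charMatrix c x y = entry ⌊ x ≟ⱽ y ⌋ (adjacent c x y)

  -- The 0 is an arbitrary choice: on lifted vertices the position of the extra copy is never
  -- consulted, as `charMatrix-lift` shows. Hence both graphs have the same `H`.
  baseMatrix : Base → Base → Poly
  baseMatrix x y = charMatrix 0 (lift x) (lift y)

  charMatrix-cong : ∀ {c c′ x x′ y y′} → (x ≡ y → x′ ≡ y′) → (x′ ≡ y′ → x ≡ y) →
    adjacent c x y ≡ adjacent c′ x′ y′ → charMatrix c x y ≡ charMatrix c′ x′ y′
  charMatrix-cong f g e = cong₂ entry (⌊⌋-⇔ f g (_ ≟ⱽ _) (_ ≟ⱽ _)) e

  charMatrix-zero : ∀ {c x y} → x ≢ y → adjacent c x y ≡ false → charMatrix c x y ≋ []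
  charMatrix-zero {c} {x} {y} x≢y = entry-zero (⌊⌋-false x≢y (x ≟ⱽ y))

  charMatrix-lift : ∀ c x y → charMatrix c (lift x) (lift y) ≡ baseMatrix x y
  charMatrix-lift c x y = cong (entry ⌊ lift x ≟ⱽ lift y ⌋) (eq x y)
    where
    eq : ∀ x y → adjacent c (lift x) (lift y) ≡ adjacent 0 (lift x) (lift y)
    eq (inj₁ _) (inj₁ _) = refl
    eq (inj₁ _) (inj₂ _) = refl
    eq (inj₂ _) (inj₁ _) = refl
    eq (inj₂ _) (inj₂ _) = refl

  lift-injective : ∀ {x y} → lift x ≡ lift y → x ≡ y
  lift-injective {inj₁ _} {inj₁ _} refl = refl
  lift-injective {inj₂ _} {inj₂ _} refl = refl

  -- Invariance under translation by whole blocks.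

  translate : ℕ → Base → Base
  translate o (inj₁ t)             = inj₁ (o * d + t)
  translate o (inj₂ ((i , j) , l)) = inj₂ ((o + i , j) , l)

  translate-injective : ∀ o {x y} → translate o x ≡ translate o y → x ≡ y
  translate-injective o {inj₁ t} {inj₁ t′} e =
    cong inj₁ (+-cancelˡ-≡ (o * d) t t′ (Sum.inj₁-injective e))
  translate-injective o {inj₂ ((i , j) , l)} {inj₂ ((i′ , j′) , l′)} e
    with refl ← +-cancelˡ-≡ o i i′ (cong (proj₁ ∘ proj₁) (Sum.inj₂-injective e))
       | refl ← cong (proj₂ ∘ proj₁) (Sum.inj₂-injective e)
       | refl ← cong proj₂ (Sum.inj₂-injective e) = refl

  position-translate : ∀ o i j → (o + i) * d + a j ≡ o * d + (i * d + a j)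
  position-translate o i j = trans (cong (_+ a j) (*-distribʳ-+ d o i)) (+-assoc (o * d) (i * d) (a j))

  on-path-translate : ∀ o t i j → ⌊ o * d + t ℕ.≟ (o + i) * d + a j ⌋ ≡ ⌊ t ℕ.≟ i * d + a j ⌋
  on-path-translate o t i j = ⌊⌋-⇔
    (λ e → +-cancelˡ-≡ (o * d) _ _ (trans e (position-translate o i j)))
    (λ e → trans (cong (o * d +_) e) (sym (position-translate o i j))) (_ ℕ.≟ _) (_ ℕ.≟ _)

  adjacent-translate : ∀ o x y →
    adjacent 0 (lift (translate o x)) (lift (translate o y)) ≡ adjacent 0 (lift x) (lift y)
  adjacent-translate o (inj₁ t) (inj₁ t′) = cong₂ _∨_ (suc-translate t t′) (suc-translate t′ t)
    where
    suc-translate : ∀ t t′ → ⌊ suc (o * d + t) ℕ.≟ o * d + t′ ⌋ ≡ ⌊ suc t ℕ.≟ t′ ⌋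
    suc-translate t t′ = ⌊⌋-⇔
      (λ e → +-cancelˡ-≡ (o * d) _ _ (trans (+-suc (o * d) t) e))
      (λ e → trans (sym (+-suc (o * d) t)) (cong (o * d +_) e)) (_ ℕ.≟ _) (_ ℕ.≟ _)
  adjacent-translate o (inj₁ t) (inj₂ ((i , j) , l)) = cong (_∧ _) (on-path-translate o t i j)
  adjacent-translate o (inj₂ ((i , j) , l)) (inj₁ t) = cong (_∧ _) (on-path-translate o t i j)
  adjacent-translate o (inj₂ ((i , j) , l)) (inj₂ ((i′ , j′) , l′)) = cong (_∧ _) (⌊⌋-⇔
    (λ e → tag (translate-injective o {inj₂ (_ , l)} {inj₂ (_ , l)} (cong (λ ij → inj₂ (ij , l)) (Maybe.just-injective e))))
    (λ e → cong just (cong (Product.map₁ (o +_)) (Maybe.just-injective e))) (_ ≟ᵀ _) (_ ≟ᵀ _))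
    where
    tag : ∀ {ij ij′ l} → _≡_ {A = Base} (inj₂ (ij , l)) (inj₂ (ij′ , l)) → just ij ≡ just ij′
    tag refl = refl

  baseMatrix-translate : ∀ o x y → baseMatrix (translate o x) (translate o y) ≡ baseMatrix x y
  baseMatrix-translate o x y = charMatrix-cong
    (λ e → cong lift (translate-injective o (lift-injective {translate o x} {translate o y} e)))
    (λ e → cong (lift ∘ translate o) (lift-injective {x} {y} e)) (adjacent-translate o x y)

  -- Cutting the path with its copies after a number of blocks.

  copies : ℕ → List Base
  copies r = concat (concatMap (λ i → tabulate λ j → tabulate λ l → inj₂ ((i , j) , l)) (upTo r))

  -- The last block lacks its final path vertex. That vertex, at `r * d ∸ 1`, is the one that joins
  -- `blocks r` to a translated segment, and for `r` equal to k the list describes all of `H`.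
  blocks : ℕ → List Base
  blocks r = map inj₁ (upTo (r * d ∸ 1)) ++ copies r

  private
    blockCopies : ℕ → List (List Base)
    blockCopies i = tabulate λ j → tabulate λ l → inj₂ ((i , j) , l)

    blockCopies-translate : ∀ r i → map (map (translate r)) (blockCopies i) ≡ blockCopies (r + i)
    blockCopies-translate r i = trans (map-tabulate _ (map (translate r)))
      (tabulate-cong λ j → map-tabulate _ (translate r))

  copies-+ : ∀ r r′ → copies (r + r′) ≡ copies r ++ map (translate r) (copies r′)
  copies-+ r r′ = begin
    concat (concatMap blockCopies (upTo (r + r′)))
      ≡⟨ cong (concat ∘ concatMap blockCopies) (upTo-+ r r′) ⟩
    concat (concatMap blockCopies (upTo r ++ map (r +_) (upTo r′)))
      ≡⟨ cong concat (concatMap-++ blockCopies (upTo r) _) ⟩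
    concat (concatMap blockCopies (upTo r) ++ concatMap blockCopies (map (r +_) (upTo r′)))
      ≡⟨ concat-++ (concatMap blockCopies (upTo r)) _ ⟨
    copies r ++ concat (concatMap blockCopies (map (r +_) (upTo r′)))
      ≡⟨ cong (λ l → copies r ++ concat l) (concatMap-map blockCopies (r +_) (upTo r′)) ⟩
    copies r ++ concat (concatMap (blockCopies ∘ (r +_)) (upTo r′))
      ≡⟨ cong (λ l → copies r ++ concat (concat l)) (map-cong (blockCopies-translate r) (upTo r′)) ⟨
    copies r ++ concat (concatMap (map (map (translate r)) ∘ blockCopies) (upTo r′))
      ≡⟨ cong (λ l → copies r ++ concat l) (map-concatMap (map (translate r)) blockCopies (upTo r′)) ⟨
    copies r ++ concat (map (map (translate r)) (concatMap blockCopies (upTo r′)))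
      ≡⟨ cong (copies r ++_) (concat-map (concatMap blockCopies (upTo r′))) ⟩
    copies r ++ map (translate r) (copies r′) ∎
    where open ≡.≡-Reasoning

  vertices-+ : ∀ r r′ → 1 ≤ r → 1 ≤ r′ →
    upTo ((r + r′) * d ∸ 1) ≡ upTo (r * d ∸ 1) ++ (r * d ∸ 1) ∷ map (r * d +_) (upTo (r′ * d ∸ 1))
  -- With at least one block on each side, every `∸ 1` cancels a visible `suc`: `suc r * d ∸ 1`
  -- computes to `d′ + r * d`.
  vertices-+ (suc r) (suc r′) _ _ = begin
    upTo ((suc r + suc r′) * d ∸ 1)                            ≡⟨ cong (λ z → upTo (z ∸ 1)) (*-distribʳ-+ d (suc r) (suc r′)) ⟩
    upTo ((d′ + r * d) + suc (d′ + r′ * d))                    ≡⟨ upTo-+-suc (d′ + r * d) (d′ + r′ * d) ⟩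
    upTo (d′ + r * d) ++ (d′ + r * d) ∷ map (suc r * d +_) (upTo (d′ + r′ * d)) ∎
    where open ≡.≡-Reasoning

  blocks-+ : ∀ r r′ → 1 ≤ r → 1 ≤ r′ →
    blocks (r + r′) ↭ inj₁ (r * d ∸ 1) ∷ blocks r ++ map (translate r) (blocks r′)
  blocks-+ r r′ 1≤r 1≤r′ = begin
    map inj₁ (upTo ((r + r′) * d ∸ 1)) ++ copies (r + r′)
      ≡⟨ cong₂ (λ u c → map inj₁ u ++ c) (vertices-+ r r′ 1≤r 1≤r′) (copies-+ r r′) ⟩
    map inj₁ (U ++ c ∷ map (r * d +_) U′) ++ (copies r ++ map (translate r) (copies r′))
      ≡⟨ cong (_++ (copies r ++ map (translate r) (copies r′))) (map-++ inj₁ U _) ⟩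
    (map inj₁ U ++ inj₁ c ∷ map inj₁ (map (r * d +_) U′)) ++ (copies r ++ map (translate r) (copies r′))
      ↭⟨ ↭.++⁺ʳ _ (↭.shift (inj₁ c) (map inj₁ U) _) ⟩
    inj₁ c ∷ (map inj₁ U ++ map inj₁ (map (r * d +_) U′)) ++ (copies r ++ map (translate r) (copies r′))
      -- The order path, path, copies, copies becomes path, copies, path, copies, so that each piece
      -- is contiguous.
      ↭⟨ prep _ (interchange (map inj₁ U) _ (copies r) _) ⟩
    inj₁ c ∷ blocks r ++ (map inj₁ (map (r * d +_) U′) ++ map (translate r) (copies r′))
      ≡⟨ cong (λ l → inj₁ c ∷ blocks r ++ (l ++ map (translate r) (copies r′))) (trans (sym (map-∘ U′)) (map-∘ U′)) ⟩
    inj₁ c ∷ blocks r ++ (map (translate r) (map inj₁ U′) ++ map (translate r) (copies r′))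
      ≡⟨ cong (λ l → inj₁ c ∷ blocks r ++ l) (map-++ (translate r) (map inj₁ U′) (copies r′)) ⟨
    inj₁ c ∷ blocks r ++ map (translate r) (blocks r′) ∎
    where
    open PermutationReasoning
    open import Algebra.Properties.CommutativeSemigroup
      (CommutativeMonoid.commutativeSemigroup (↭.++-commutativeMonoid {A = Base}))
      using (interchange)
    U U′ : List ℕ
    U  = upTo (r * d ∸ 1)
    U′ = upTo (r′ * d ∸ 1)
    c : ℕ
    c = r * d ∸ 1

  -- The cut vertex `m * d ∸ 1` lies in neither class; this gap of one vertex keeps the two parts of
  -- the path nonadjacent.
  Before After : ℕ → Base → Set
  Before m (inj₁ t)             = suc t < m * d
  Before m (inj₂ ((i , _) , _)) = i < m
  After  m (inj₁ t)             = m * d ≤ t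
  After  m (inj₂ ((i , _) , _)) = m ≤ i

  before-blocks : ∀ m → All (Before m) (blocks m)
  before-blocks m = All.++⁺
    (All.map⁺ (All.map (<∸1⇒suc< (m * d)) (All.all-upTo (m * d ∸ 1))))
    (All.concat⁺ (All.concat⁺ (All.map⁺ (All.map (λ i<m → All.tabulate⁺ λ _ → All.tabulate⁺ λ _ → i<m) (All.all-upTo m)))))
    where
    <∸1⇒suc< : ∀ n {t} → t < n ∸ 1 → suc t < n
    <∸1⇒suc< (suc n) t<n = s≤s t<n

  after-translate : ∀ m xs → All (After m) (map (translate m) xs)
  after-translate m xs = All.map⁺ (All.universal after xs)
    where
    after : ∀ x → After m (translate m x)
    after (inj₁ t)             = m≤m+n (m * d) t
    after (inj₂ ((i , _) , _)) = m≤m+n m i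

  position-before : ∀ {m i} j → i < m → i * d + a j < m * d
  position-before {m} {i} j i<m = begin-strict
    i * d + a j <⟨ +-monoʳ-< (i * d) (a<d j) ⟩
    i * d + d   ≡⟨ +-comm (i * d) d ⟩
    suc i * d   ≤⟨ *-monoˡ-≤ d i<m ⟩
    m * d       ∎
    where open ≤-Reasoning

  position-after : ∀ {m i} j → m ≤ i → m * d ≤ i * d + a j
  position-after {m} {i} j m≤i = ≤-trans (*-monoˡ-≤ d m≤i) (m≤m+n (i * d) (a j))

  -- A copy with block index `i` is attached at a position from `i * d` up to, but excluding,
  -- `suc i * d`, hence never across the cut.
  before-after-zero : ∀ m {x y} → Before m x → After m y → baseMatrix x y ≋ []
  before-after-zero m {x} {y} b f = charMatrix-zero (distinct x y b f ∘ lift-injective) (nonadjacent x y b f)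
    where
    distinct : ∀ x y → Before m x → After m y → x ≢ y
    distinct (inj₁ t) _ b f refl = <⇒≱ (<-trans (n<1+n t) b) f
    distinct (inj₂ _) _ b f refl = <⇒≱ b f
    nonadjacent : ∀ x y → Before m x → After m y → adjacent 0 (lift x) (lift y) ≡ false
    nonadjacent (inj₁ t) (inj₁ t′) b f = cong₂ _∨_
      (⌊⌋-false (λ e → <⇒≱ b (≤-trans f (≤-reflexive (sym e)))) (_ ℕ.≟ _))
      (⌊⌋-false (λ e → <⇒≱ (<-trans (n<1+n t) b) (≤-trans f (≤-trans (n≤1+n t′) (≤-reflexive e)))) (_ ℕ.≟ _))
    nonadjacent (inj₁ t) (inj₂ ((i , j) , l)) b f = cong (_∧ _)
      (⌊⌋-false (λ e → <⇒≱ (<-trans (n<1+n t) b) (≤-trans (position-after j f) (≤-reflexive (sym e)))) (_ ℕ.≟ _))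
    nonadjacent (inj₂ ((i , j) , l)) (inj₁ t) b f = cong (_∧ _)
      (⌊⌋-false (λ e → <⇒≱ (position-before j b) (≤-trans f (≤-reflexive e))) (_ ℕ.≟ _))
    nonadjacent (inj₂ ((i , j) , l)) (inj₂ ((i′ , j′) , l′)) b f = cong (_∧ _)
      (⌊⌋-false (λ { refl → <⇒≱ b f }) (just (i , j) ≟ᵀ just (i′ , j′)))

  -- The condition for having no edge to the non-root vertices of the extra copy at `c`: among path
  -- vertices only `c` has one, and other copies carry a different tag.
  OffPath : ℕ → Base → Set
  OffPath c (inj₁ t) = t ≢ c
  OffPath c (inj₂ _) = ⊤

  before⇒offPath : ∀ m x → Before m x → OffPath (m * d ∸ 1) x
  before⇒offPath m (inj₁ t) b e = <⇒≱ b (≡∸1⇒≤suc (m * d) e)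
    where
    ≡∸1⇒≤suc : ∀ n → t ≡ n ∸ 1 → n ≤ suc t
    ≡∸1⇒≤suc zero    _    = z≤n
    ≡∸1⇒≤suc (suc n) refl = ≤-refl
  before⇒offPath m (inj₂ _) b = tt

  after⇒offPath : ∀ m x → 1 ≤ m → After m x → OffPath (m * d ∸ 1) x
  after⇒offPath (suc m) (inj₁ t) _ f refl = <⇒≱ (n<1+n t) f
  after⇒offPath m       (inj₂ _) _ f = tt

  -- The extra copy of `G`, without and with its root.

  extras : List Vertex
  extras = map extra (allFin q)

  -- A parametrisation of the whole extra copy, root included, by a type free of `c`; it lets the
  -- copies at v and at w be compared entry by entry.
  rooted : ℕ → Maybe (Fin q) → Vertex
  rooted c nothing  = inj₁ c
  rooted c (just l) = extra l

  rooted-injective : ∀ c {x y} → rooted c x ≡ rooted c y → x ≡ y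
  rooted-injective c {nothing} {nothing} _    = refl
  rooted-injective c {just _}  {just _}  refl = refl

  charMatrix-rooted : ∀ c x y → charMatrix c (rooted c x) (rooted c y) ≡ charMatrix 0 (rooted 0 x) (rooted 0 y)
  charMatrix-rooted c x y = charMatrix-cong
    (λ e → cong (rooted 0) (rooted-injective c e)) (λ e → cong (rooted c) (rooted-injective 0 e)) (eq x y)
    where
    1+n≟n : ∀ n → ⌊ suc n ℕ.≟ n ⌋ ≡ false
    1+n≟n n = ⌊⌋-false 1+n≢n (suc n ℕ.≟ n)
    n≟n : ∀ n → ⌊ n ℕ.≟ n ⌋ ≡ true
    n≟n n = ⌊⌋-true refl (n ℕ.≟ n)
    eq : ∀ x y → adjacent c (rooted c x) (rooted c y) ≡ adjacent 0 (rooted 0 x) (rooted 0 y)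
    eq nothing  nothing  = cong₂ _∨_ (1+n≟n c) (1+n≟n c)
    eq nothing  (just _) = cong (_∧ _) (n≟n c)
    eq (just _) nothing  = cong (_∧ _) (n≟n c)
    eq (just _) (just _) = refl

  -- The characteristic polynomial as a function of the cut.

  open CommutativeRing polyRing using (setoid; +-cong; *-cong; +-congˡ; *-congˡ; *-comm; -‿cong; _-_)
    renaming (reflexive to ≋-reflexive; trans to ≋-trans; refl to ≋-refl; sym to ≋-sym)

  principal-rooted : ∀ c xs → principal (charMatrix c) (map (rooted c) xs) ≋ principal (charMatrix 0) (map (rooted 0) xs)
  principal-rooted c = principal-relabel (rooted c) (rooted 0) (λ x y → ≋-reflexive (charMatrix-rooted c x y))

  principal-lift : ∀ c xs → principal (charMatrix c) (map lift xs) ≋ principal baseMatrix xs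
  principal-lift c xs = ≋-trans (principal-map (charMatrix c) lift xs)
    (principal-cong (λ x y → ≋-reflexive (charMatrix-lift c x y)) xs)

  charBlocks : ℕ → Poly
  charBlocks r = principal baseMatrix (blocks r)

  charBlocks-* : ∀ r r′ →
    principal baseMatrix (blocks r ++ map (translate r) (blocks r′)) ≋ charBlocks r *P charBlocks r′
  charBlocks-* r r′ = begin
    principal baseMatrix (blocks r ++ map (translate r) (blocks r′))
      ≈⟨ principal-++ baseMatrix (blocks r) _
           (All.map (λ b → All.map (before-after-zero r b) (after-translate r (blocks r′))) (before-blocks r)) ⟩
    charBlocks r *P principal baseMatrix (map (translate r) (blocks r′))
      ≈⟨ *-congˡ {charBlocks r} (principal-map baseMatrix (translate r) (blocks r′)) ⟩
    charBlocks r *P principal (λ x y → baseMatrix (translate r x) (translate r y)) (blocks r′)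
      ≈⟨ *-congˡ {charBlocks r} (principal-cong (λ x y → ≋-reflexive (baseMatrix-translate r x y)) (blocks r′)) ⟩
    charBlocks r *P charBlocks r′ ∎
    where open import Relation.Binary.Reasoning.Setoid setoid

  pendant : List Vertex
  pendant = map (rooted 0) (map just (allFin q))

  -- Here `z` stands for φ(H - v). The two leading factors are φ(G) and φ(G - r), computed with the
  -- copy moved to position 0, `charBlocks k` is φ(H), and the diagonal entry is x. The cut enters
  -- through `z` alone.
  coalescencePoly : ℕ → Poly → Poly
  coalescencePoly k z =
    principal (charMatrix 0) (inj₁ 0 ∷ pendant) *P z +P
    principal (charMatrix 0) pendant *P (charBlocks k - charMatrix 0 (inj₁ 0) (inj₁ 0) *P z)

  principal-coalescence : ∀ r r′ → 1 ≤ r → 1 ≤ r′ →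
    principal (charMatrix (r * d ∸ 1)) (extras ++ map lift (blocks (r + r′))) ≋
    coalescencePoly (r + r′) (charBlocks r *P charBlocks r′)
  principal-coalescence r r′ 1≤r 1≤r′ = begin
    principal M (extras ++ map lift (blocks (r + r′)))
      ≈⟨ principal-↭ M (↭.++⁺ˡ extras (↭.map⁺ lift split)) ⟩
    principal M (extras ++ v ∷ map lift Y)
      ≈⟨ principal-↭ M (↭.shift v extras (map lift Y)) ⟩
    principal M (v ∷ extras ++ map lift Y)
      ≡⟨ cong (λ l → principal M (v ∷ l ++ map lift Y)) (map-∘ (allFin q)) ⟩
    principal M (v ∷ X ++ map lift Y)
      ≈⟨ principal-coalesce M v X (map lift Y) α β α+β α-zero β-zero
           (All.map⁺ (All.map⁺ (All.universal (λ l → All.map⁺ (All.map (λ {y} → extra-lift l y) off)) (allFin q))))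
           (All.map⁺ (All.map (λ {y} o → All.map⁺ (All.map⁺ (All.universal (λ l → lift-extra l y o) (allFin q)))) off)) ⟩
    principal M (v ∷ X) *P principal M (map lift Y) +P
      principal M X *P (principal M (map lift (inj₁ c ∷ Y)) - M v v *P principal M (map lift Y))
      ≈⟨ +-cong
           (*-cong (principal-rooted c (nothing ∷ map just (allFin q))) Y-poly)
           (*-cong (principal-rooted c (map just (allFin q)))
             -- Returning `c` to the two pieces restores the whole of `H`, so this factor forgets
             -- where the cut was made.
             (+-cong (≋-trans (principal-lift c (inj₁ c ∷ Y)) (principal-↭ baseMatrix (↭-sym split)))
               (-‿cong (*-cong (≋-reflexive (charMatrix-rooted c nothing nothing)) Y-poly)))) ⟩
    coalescencePoly (r + r′) (charBlocks r *P charBlocks r′) ∎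
    where
    open import Relation.Binary.Reasoning.Setoid setoid
    c : ℕ
    c = r * d ∸ 1
    M : Vertex → Vertex → Poly
    M = charMatrix c
    v : Vertex
    v = inj₁ c
    X : List Vertex
    X = map (rooted c) (map just (allFin q))
    Y : List Base
    Y = blocks r ++ map (translate r) (blocks r′)
    split : blocks (r + r′) ↭ inj₁ c ∷ Y
    split = blocks-+ r r′ 1≤r 1≤r′
    Y-poly : principal M (map lift Y) ≋ charBlocks r *P charBlocks r′
    Y-poly = ≋-trans (principal-lift c Y) (charBlocks-* r r′)
    off : All (OffPath c) Y
    off = All.++⁺ (All.map (λ {x} → before⇒offPath r x) (before-blocks r))
                  (All.map (λ {x} → after⇒offPath r x 1≤r) (after-translate r (blocks r′)))
    extra-lift : ∀ l y → OffPath c y → M (extra l) (lift y) ≋ []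
    extra-lift l (inj₁ t) t≢c = charMatrix-zero {c} {extra l} {inj₁ t}
      (λ ()) (cong (_∧ _) (⌊⌋-false t≢c (t ℕ.≟ c)))
    extra-lift l (inj₂ (ij , l′)) _ = charMatrix-zero {c} {extra l} {lift (inj₂ (ij , l′))} (λ ()) refl
    lift-extra : ∀ l y → OffPath c y → M (lift y) (extra l) ≋ []
    lift-extra l (inj₁ t) t≢c = charMatrix-zero {c} {inj₁ t} {extra l}
      (λ ()) (cong (_∧ _) (⌊⌋-false t≢c (t ℕ.≟ c)))
    lift-extra l (inj₂ (ij , l′)) _ = charMatrix-zero {c} {lift (inj₂ (ij , l′))} {extra l} (λ ()) refl

    -- The root `c` counts as part of the copy, which sends the diagonal entry of row `v` to `α` and
    -- makes `β` vanish at `v`.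
    inCopy : Vertex → Bool
    inCopy (inj₁ t)             = ⌊ t ℕ.≟ c ⌋
    inCopy (inj₂ (nothing , _)) = true
    inCopy (inj₂ (just _  , _)) = false
    α β : Vertex → Poly
    α y = if inCopy y then M v y else []
    β y = if inCopy y then [] else M v y
    α+β : ∀ y → M v y ≋ α y +P β y
    α+β y with inCopy y
    ... | true  = ≋-sym (CommutativeRing.+-identityʳ polyRing (M v y))
    ... | false = ≋-refl
    α-off : ∀ y → OffPath c y → α (lift y) ≋ []
    α-off (inj₁ t) t≢c rewrite ⌊⌋-false t≢c (t ℕ.≟ c) = ≋-refl
    α-off (inj₂ _) _ = ≋-refl
    α-zero : All (λ y → α y ≋ []) (map lift Y)
    α-zero = All.map⁺ (All.map (λ {y} → α-off y) off)
    β-rooted : ∀ x → β (rooted c x) ≋ []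
    β-rooted nothing  rewrite ⌊⌋-true refl (c ℕ.≟ c) = ≋-refl
    β-rooted (just _) = ≋-refl
    β-zero : All (λ y → β y ≋ []) (v ∷ X)
    β-zero = All.map⁺ (All.universal β-rooted (nothing ∷ map just (allFin q)))

  -- Translating the given coalescence into labelled form.

  tag : ∀ k → Fin (suc (k * p)) → Maybe (ℕ × Fin p)
  tag k zero    = nothing
  tag k (suc t) = just (Product.map₁ toℕ (remQuot {k} p t))

  tag-injective : ∀ k {s t} → tag k s ≡ tag k t → s ≡ t
  tag-injective k {zero}  {zero}  _ = refl
  tag-injective k {suc s} {suc t} e = cong suc (remQuot-injective k p (Product.×-≡,≡→≡
    (Fin.toℕ-injective (cong proj₁ (Maybe.just-injective e)) , cong proj₂ (Maybe.just-injective e))))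

  label : ∀ n k → Fin n ⊎ Fin (suc (k * p) * q) → Vertex
  label n k = Sum.map toℕ (Product.map₁ (tag k) ∘ remQuot {suc (k * p)} q)

  label-injective : ∀ n k {x y} → label n k x ≡ label n k y → x ≡ y
  label-injective n k {inj₁ _} {inj₁ _} e = cong inj₁ (Fin.toℕ-injective (Sum.inj₁-injective e))
  label-injective n k {inj₂ _} {inj₂ _} e = cong inj₂ (remQuot-injective (suc (k * p)) q (Product.×-≡,≡→≡
    (tag-injective k (cong proj₁ (Sum.inj₂-injective e)) , cong proj₂ (Sum.inj₂-injective e))))


  -- Attachment index 0 is the extra copy, so its vertices are listed between the path and the other
  -- copies; they only have to be moved to the front.
  tabulate-label : ∀ k → let n = k * d ∸ 1 in
    tabulate (label n k ∘ splitAt n) ↭ extras ++ map lift (blocks k)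
  tabulate-label k = begin
    tabulate (label n k ∘ splitAt n)
      ≡⟨ tabulate-splitAt n (suc (k * p) * q) (label n k) ⟩
    tabulate (inj₁ ∘ toℕ) ++ tabulate (inj₂ ∘ Product.map₁ (tag k) ∘ remQuot {suc (k * p)} q)
      ≡⟨ ≡.cong₂ _++_ vertices-label copies-label ⟩
    map lift (map inj₁ (upTo n)) ++ (extras ++ map lift (copies k))
      ↭⟨ swap-front (map lift (map inj₁ (upTo n))) extras (map lift (copies k)) ⟩
    extras ++ (map lift (map inj₁ (upTo n)) ++ map lift (copies k))
      ≡⟨ cong (extras ++_) (map-++ lift (map inj₁ (upTo n)) (copies k)) ⟨
    extras ++ map lift (blocks k) ∎
    where
    open PermutationReasoning
    n : ℕ
    n = k * d ∸ 1
    swap-front : ∀ (xs ys zs : List Vertex) → xs ++ (ys ++ zs) ↭ ys ++ (xs ++ zs)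
    swap-front xs ys zs = ↭-trans (↭-reflexive (sym (++-assoc xs ys zs)))
      (↭-trans (↭.++⁺ʳ zs (↭.++-comm xs ys)) (↭-reflexive (++-assoc ys xs zs)))
    vertices-label : tabulate {n = n} (inj₁ ∘ toℕ) ≡ map lift (map inj₁ (upTo n))
    vertices-label = trans (tabulate-toℕ n inj₁) (map-∘ (upTo n))
    block : ℕ → List (List Vertex)
    block i = tabulate λ j → tabulate λ l → lift (inj₂ ((i , j) , l))
    block-lift : ∀ i → block i ≡ map (map lift) (blockCopies i)
    block-lift i = sym (trans (map-tabulate _ (map lift)) (tabulate-cong λ j → map-tabulate _ lift))
    copies-label : tabulate (inj₂ ∘ Product.map₁ (tag k) ∘ remQuot {suc (k * p)} q) ≡ extras ++ map lift (copies k)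
    copies-label = ≡.trans (tabulate-remQuot (suc (k * p)) q (inj₂ ∘ Product.map₁ (tag k)))
      (cong₂ _++_ (sym (map-tabulate id extra)) (≡R.begin
        concat (tabulate {n = k * p} (λ t → tabulate λ l → inj₂ (tag k (suc t) , l)))
          ≡R.≡⟨ cong concat (tabulate-remQuot k p (λ { (i , j) → tabulate λ l → lift (inj₂ ((toℕ i , j) , l)) })) ⟩
        concat (concat (tabulate {n = k} (block ∘ toℕ)))
          ≡R.≡⟨ cong (concat ∘ concat) (trans (tabulate-toℕ k block) (map-cong block-lift (upTo k))) ⟩
        concat (concatMap (map (map lift) ∘ blockCopies) (upTo k))
          ≡R.≡⟨ cong concat (map-concatMap (map lift) blockCopies (upTo k)) ⟨
        concat (map (map lift) (concatMap blockCopies (upTo k)))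
          ≡R.≡⟨ concat-map (concatMap blockCopies (upTo k)) ⟩
        map lift (copies k) ≡R.∎))
      where module ≡R = ≡.≡-Reasoning

  module _ (k : ℕ) {n c : ℕ} (x : Fin (suc (k * p)) → Fin n)
           (x₀ : toℕ (x zero) ≡ c) (xₛ : ∀ t → toℕ (x (suc t)) ≡ uPoint k p d a t) where
    open AdjGraph (coalesce (pathAdj n) G x)

    attachment : ∀ s → toℕ (x s) ≡ position c (tag k s)
    attachment zero    = x₀
    attachment (suc t) = trans (xₛ t) uPoint-position
      where
      uPoint-position : uPoint k p d a t ≡ position c (tag k (suc t))
      uPoint-position with remQuot {k} p t
      ... | _ , _ = refl

    at-attachment : ∀ (t : Fin n) s → ⌊ t Fin.≟ x s ⌋ ≡ ⌊ toℕ t ℕ.≟ position c (tag k s) ⌋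
    at-attachment t s = ⌊⌋-⇔ (λ { refl → attachment s })
      (λ e → Fin.toℕ-injective (trans e (sym (attachment s)))) (_ Fin.≟ _) (_ ℕ.≟ _)

    -- Both relations have the same four clauses. Only the equality tests change type, and
    -- injectivity of `toℕ` and `tag` preserves their outcomes.
    mat-label : ∀ i j → mat i j ≡ adjacent c (label n k (splitAt n i)) (label n k (splitAt n j))
    mat-label i j with splitAt n i | splitAt n j
    ... | inj₁ _ | inj₁ _ = refl
    ... | inj₁ t | inj₂ _ = cong (_∧ _) (at-attachment t _)
    ... | inj₂ _ | inj₁ t = cong (_∧ _) (at-attachment t _)
    ... | inj₂ u | inj₂ v = cong (_∧ _) (⌊⌋-⇔ (cong (tag k)) (tag-injective k)
                                (copy u Fin.≟ copy v) (tag k (copy u) ≟ᵀ tag k (copy v)))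
      where
      copy : Fin (suc (k * p) * q) → Fin (suc (k * p))
      copy = Fin.quotient {suc (k * p)} q

    charPoly-principal : charPoly size mat ≡ principal (charMatrix c) (tabulate (label n k ∘ splitAt n))
    charPoly-principal = det≡principal size _ (charMatrix c) (label n k ∘ splitAt n) λ i j → cong₂ entry
      (⌊⌋-⇔ (cong (label n k ∘ splitAt n))
            (splitAt-injective n _ ∘ label-injective n k) (i Fin.≟ j) (_ ≟ⱽ _))
      (mat-label i j)

  -- The right-hand side is symmetric in `r` and `r′` up to commutativity, although the extra copy
  -- sits at `r * d ∸ 1`. The two graphs are the cases (m, k - m) and (k - m, m).
  charPoly-coalesce : ∀ k r r′ → r + r′ ≡ k → 1 ≤ r → 1 ≤ r′ →
    (x : Fin (suc (k * p)) → Fin (k * d ∸ 1)) →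
    toℕ (x zero) ≡ r * d ∸ 1 → (∀ t → toℕ (x (suc t)) ≡ uPoint k p d a t) →
    let open AdjGraph (coalesce (pathAdj (k * d ∸ 1)) G x) in
    charPoly size mat ≋ coalescencePoly k (charBlocks r *P charBlocks r′)
  charPoly-coalesce k r r′ refl 1≤r 1≤r′ x x₀ xₛ = ≋-trans
    (≋-reflexive (charPoly-principal k x x₀ xₛ))
    (≋-trans (principal-↭ (charMatrix (r * d ∸ 1)) (tabulate-label k)) (principal-coalescence r r′ 1≤r 1≤r′))

  coalescencePoly-cong : ∀ k {z z′} → z ≋ z′ → coalescencePoly k z ≋ coalescencePoly k z′
  coalescencePoly-cong k e = +-cong
    (*-congˡ {principal (charMatrix 0) (inj₁ 0 ∷ pendant)} e)
    (*-congˡ {principal (charMatrix 0) pendant}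
      (+-congˡ {charBlocks k} (-‿cong (*-congˡ {charMatrix 0 (inj₁ 0) (inj₁ 0)} e))))

theorem2 : (k m d p : ℕ) → 3 ≤ k → 2 ≤ d → 1 ≤ m → 2 * m < k → 1 ≤ p
    → (a : Fin p → ℕ)
    → (∀ i j → i Fin.< j → a i < a j)
    → (∀ j → a j ≤ d ∸ 2)
    → (G : RootedGraph)
    → (x y : Fin (suc (k * p)) → Fin (k * d ∸ 1))
    → toℕ (x zero) ≡ m * d ∸ 1
    → toℕ (y zero) ≡ (k ∸ m) * d ∸ 1
    → (∀ t → toℕ (x (suc t)) ≡ uPoint k p d a t)
    → (∀ t → toℕ (y (suc t)) ≡ uPoint k p d a t)
    → Cospectral (coalesce (pathAdj (k * d ∸ 1)) G x)
    (coalesce (pathAdj (k * d ∸ 1)) G y)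
theorem2 k m (suc (suc e)) p _ (s≤s (s≤s _)) 1≤m 2m<k _ a _ a≤e G x y x₀ y₀ xₛ yₛ = _≋_.coeffs (begin
  charPoly X.size X.mat
    ≈⟨ charPoly-coalesce k m (k ∸ m) (m+[n∸m]≡n m≤k) 1≤m 1≤k∸m x x₀ xₛ ⟩
  coalescencePoly k (charBlocks m *P charBlocks (k ∸ m))
    ≈⟨ coalescencePoly-cong k (*P-comm (charBlocks m) (charBlocks (k ∸ m))) ⟩
  coalescencePoly k (charBlocks (k ∸ m) *P charBlocks m)
    ≈⟨ charPoly-coalesce k (k ∸ m) m (m∸n+n≡m m≤k) 1≤k∸m 1≤m y y₀ yₛ ⟨
  charPoly Y.size Y.mat ∎)
  where
  open Coalescence (suc e) p a (λ j → s≤s (m≤n⇒m≤1+n (a≤e j))) G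
  open import Relation.Binary.Reasoning.Setoid (CommutativeRing.setoid polyRing)
  module X = AdjGraph (coalesce (pathAdj (k * suc (suc e) ∸ 1)) G x)
  module Y = AdjGraph (coalesce (pathAdj (k * suc (suc e) ∸ 1)) G y)
  m<k : m < k
  -- `2 * m` computes to `m + (m + 0)`.
  m<k = ≤-<-trans (m≤m+n m (m + 0)) 2m<k
  m≤k : m ≤ k
  m≤k = <⇒≤ m<k
  1≤k∸m : 1 ≤ k ∸ m
  1≤k∸m = m<n⇒0<n∸m m<k
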